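{- Fix an integer $d\ge 1$. There is an algorithm which, given an integer $n\ge1$, a finite bipartite $(2d,2)$-Helly graph $H$ and a graph homomorphism $f\in\mathrm{Hom}(\partial_n,H)$, decides the hole-filling problem for $f$, i.e. decides whether there exists $\tilde f\in\mathrm{Hom}(B_n,H)$ with $\tilde f|_{\partial_n}=f$, in time polynomial in $n+|H|$ (the polynomial depending only on $d$).
   Context: Graphs are nonempty, connected and simple; $H$ is presented by its adjacency matrix and $|H|$ is its number of vertices. $B_n=\{0,1,\dots,n\}^d$ is the box, viewed as an induced subgraph of the Cayley graph of $\mathbb{Z}^d$ with standard generators. $\partial_n$ is the internal vertex boundary of $B_n$: the induced subgraph on vertices of $B_n$ with at least one coordinate equal to $0$ or $n$. $\mathrm{Hom}(G,H)$ is the set of graph homomorphisms (adjacency-preserving vertex maps) from $G$ to $H$. In this statement, "bipartite $(2d,2)$-Helly graph" means: $H$ is a bipartite graph such that for all (not necessarily distinct) balls $B_1,\dots,B_{2d}$ in $H$ (closed balls of non-negative integer radius for the path metric) and each partite class $H_1$ of $H$, if $B_i\cap B_j\cap H_1\neq\varnothing$ for all $i\neq j$, then $\bigcap_{i=1}^{2d}(B_i\cap H_1)\neq\varnothing$. -}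

module Defs where

open import Data.Bool using (Bool; true; false; T; if_then_else_)
open import Data.Fin using (Fin; toℕ; fromℕ<; remQuot)
open import Data.Fin.Properties using (toℕ-injective)
import Data.Integer as ℤ
import Data.Integer.Properties as ℤ
open import Data.Irrelevant using ([_])
open import Data.List using (List; foldr)
open import Data.Nat using (ℕ; zero; suc; _+_; _*_; _∸_; _^_; _≤_; _≟_; _<?_)
open import Data.Product using (∃-syntax; Σ-syntax; _×_; _,_; uncurry)
open import Data.Refinement using (Refinement; value; _,_)
open import Data.Refinement.Properties using (value-injective)
open import Data.Sum using (_⊎_; inj₁; inj₂)
open import Data.Vec using (Vec; []; _∷_; map; updateAt)
open import Data.Vec.Properties using (∷-injectiveˡ; ∷-injectiveʳ)
open import Data.Vec.Relation.Unary.Any using (Any; any?)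
open import Function using (_∘_; Injective)
open import Level using (0ℓ)
open import Relation.Binary using (Rel; Symmetric; Irreflexive)
open import Relation.Binary.PropositionalEquality
  using (_≡_; _≢_; refl; cong; cong₂)
open import Relation.Nullary using (¬_; yes; no; does)
open import Relation.Nullary.Decidable using (_⊎-dec_)
open import Relation.Unary using (Pred; Decidable)

------------------------------------------------------------------------
-- Graphs

-- Simple undirected graphs; connectedness and nonemptiness are separate
-- conditions, since the boundary of {0,…,n} ⊆ ℤ is disconnected for n ≥ 2.
record Graph : Set₁ where
  field
    Vertex   : Set
    _~_      : Rel Vertex 0ℓ
    ~-sym    : Symmetric _~_
    ~-irrefl : Irreflexive _≡_ _~_

open Graph using (Vertex)

_⊢_~_ : (G : Graph) → Rel (Vertex G) 0ℓ
_⊢_~_ = Graph._~_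

record Hom (G H : Graph) : Set where
  field
    app      : Vertex G → Vertex H
    app-pres : ∀ {u v} → G ⊢ u ~ v → H ⊢ app u ~ app v

open Hom public using (app)

-- The subgraph induced on the image of an injection.
induced : (G : Graph) {A : Set} (ι : A → Vertex G) → Injective _≡_ _≡_ ι → Graph
induced G {A} ι _ = record
  { Vertex   = A
  ; _~_      = λ a b → G ⊢ ι a ~ ι b
  ; ~-sym    = Graph.~-sym G
  ; ~-irrefl = λ a≡b → Graph.~-irrefl G (cong ι a≡b)
  }

module _ (G : Graph) where

  data Walk : Vertex G → Vertex G → ℕ → Set where
    []  : ∀ {u} → Walk u u 0
    _∷_ : ∀ {u v w k} → G ⊢ u ~ v → Walk v w k → Walk u w (suc k)

  Connected : Set
  Connected = ∀ u v → ∃[ k ] Walk u v k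

  IsDistance : Vertex G → Vertex G → ℕ → Set
  IsDistance u v k = Walk u v k × (∀ j → Walk u v j → k ≤ j)

  Ball : Vertex G → ℕ → Pred (Vertex G) 0ℓ
  Ball c r v = ∃[ k ] IsDistance c v k × k ≤ r

  -- The partite classes are the two fibres of side.
  IsBipartition : (Vertex G → Bool) → Set
  IsBipartition side = ∀ {u v} → G ⊢ u ~ v → side u ≢ side v

  -- Bipartite (k,2)-Helly.  For connected G the bipartition is unique up to
  -- exchanging the classes, so it does not matter which one is taken.
  BipartiteHelly : ℕ → Set
  BipartiteHelly k = ∃[ side ] IsBipartition side ×
    ((centre : Fin k → Vertex G) (radius : Fin k → ℕ) (class : Bool) →
     (∀ i j → i ≢ j → ∃[ v ] Ball (centre i) (radius i) v
                           × Ball (centre j) (radius j) v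
                           × side v ≡ class) →
     ∃[ v ] (∀ i → Ball (centre i) (radius i) v × side v ≡ class))

record FiniteGraph : Set where
  field
    order      : ℕ
    adj        : Fin order → Fin order → Bool
    adj-sym    : ∀ u v → adj u v ≡ adj v u
    adj-irrefl : ∀ u → adj u u ≡ false

  graph : Graph
  graph = record
    { Vertex   = Fin order
    ; _~_      = λ u v → T (adj u v)
    ; ~-sym    = λ {u} {v} → symm u v
    ; ~-irrefl = λ { {u} refl → irr u }
    }
    where
    symm : ∀ u v → T (adj u v) → T (adj v u)
    symm u v p rewrite adj-sym u v = p

    irr : ∀ u → ¬ T (adj u u)
    irr u p rewrite adj-irrefl u = p

open FiniteGraph using (order; adj; graph)

------------------------------------------------------------------------
-- The lattice, the box and its boundary

-- updateAt x i ℤ.suc is x + eᵢ, so neighbours are x + eᵢ and x - eᵢ.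
lattice : ℕ → Graph
lattice d = record
  { Vertex   = Vec ℤ.ℤ d
  ; _~_      = λ x y → ∃[ i ] (y ≡ updateAt x i ℤ.suc ⊎ x ≡ updateAt y i ℤ.suc)
  ; ~-sym    = λ { (i , inj₁ p) → i , inj₂ p ; (i , inj₂ p) → i , inj₁ p }
  ; ~-irrefl = λ { {x} refl (i , inj₁ p) → fixed x i p ; {x} refl (i , inj₂ p) → fixed x i p }
  }
  where
  fixed : ∀ {d} (x : Vec ℤ.ℤ d) i → x ≢ updateAt x i ℤ.suc
  fixed (x ∷ xs) Fin.zero    p = ℤ.i≢suc[i] (∷-injectiveˡ p)
  fixed (x ∷ xs) (Fin.suc i) p = fixed xs i (∷-injectiveʳ p)

point : ∀ {m d} → Vec (Fin m) d → Vec ℤ.ℤ d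
point = map (ℤ.+_ ∘ toℕ)

point-injective : ∀ {m d} → Injective _≡_ _≡_ (point {m} {d})
point-injective {x = []}    {y = []}    _ = refl
point-injective {x = a ∷ x} {y = b ∷ y} p =
  cong₂ _∷_ (toℕ-injective (ℤ.+-injective (∷-injectiveˡ p)))
            (point-injective (∷-injectiveʳ p))

Box : (d n : ℕ) → Graph
Box d n = induced (lattice d) {Vec (Fin (suc n)) d} point point-injective

OnBoundary : ∀ {d} n → Pred (Vec (Fin (suc n)) d) 0ℓ
OnBoundary n = Any (λ c → toℕ c ≡ 0 ⊎ toℕ c ≡ n)

onBoundary? : ∀ {d} n → Decidable (OnBoundary {d} n)
onBoundary? n = any? (λ c → (toℕ c ≟ 0) ⊎-dec (toℕ c ≟ n))

-- The membership proof is irrelevant, so each boundary point of the box is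
-- exactly one vertex of the boundary graph.
Boundary : (d n : ℕ) → Graph
Boundary d n = induced (Box d n) {Refinement _ (OnBoundary n)} value value-injective

Fillable : ∀ d n (H : Graph) → Hom (Boundary d n) H → Set
Fillable d n H f =
  Σ[ f̃ ∈ Hom (Box d n) H ] (∀ x → app f̃ (value x) ≡ app f x)

------------------------------------------------------------------------
-- Model of computation: structured random-access programs

-- A program uses registers and one-dimensional arrays, both named by ℕ and
-- holding unbounded naturals.  Arithmetic is limited to _+_ and _∸_, each of
-- unit cost: values then have O(t) more bits after time t than initially,
-- so polynomial time agrees with polynomial time on Turing machines (unit-cost
-- multiplication would break this).

data Expr : Set where
  lit       : ℕ → Expr
  reg       : ℕ → Expr
  _at_      : ℕ → Expr → Expr   -- array, index
  _⊕_ _⊖_   : Expr → Expr → Expr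

data Program : Set where
  skip          : Program
  _≔_           : ℕ → Expr → Program
  _at_≔_        : ℕ → Expr → Expr → Program
  _⨟_           : Program → Program → Program
  ifNonzero     : Expr → Program → Program → Program
  whileNonzero  : Expr → Program → Program

record State : Set where
  constructor ⟨_,_⟩
  field
    register : ℕ → ℕ
    array    : ℕ → ℕ → ℕ

open State public

_[_↦_] : {A : Set} → (ℕ → A) → ℕ → A → ℕ → A
(g [ i ↦ a ]) j = if does (j ≟ i) then a else g j

setRegister : State → ℕ → ℕ → State
setRegister s r v = ⟨ register s [ r ↦ v ] , array s ⟩

setArray : State → ℕ → ℕ → ℕ → State
setArray s a i v = ⟨ register s , array s [ a ↦ array s a [ i ↦ v ] ] ⟩

eval : Expr → State → ℕ
eval (lit k)  s = k
eval (reg r)  s = register s r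
eval (a at e) s = array s a (eval e s)
eval (e ⊕ e′) s = eval e s + eval e′ s
eval (e ⊖ e′) s = eval e s ∸ eval e′ s

cost : Expr → ℕ
cost (lit _)  = 1
cost (reg _)  = 1
cost (_ at e) = 1 + cost e
cost (e ⊕ e′) = 1 + cost e + cost e′
cost (e ⊖ e′) = 1 + cost e + cost e′

-- P ∶ s ⇓ s′ in-time t: started in s, the program P halts in s′ after exactly
-- t elementary steps.
data _∶_⇓_in-time_ : Program → State → State → ℕ → Set where
  skip       : ∀ {s} → skip ∶ s ⇓ s in-time 1
  assign     : ∀ {s r e} →
               (r ≔ e) ∶ s ⇓ setRegister s r (eval e s) in-time (1 + cost e)
  store      : ∀ {s a i e} →
               (a at i ≔ e) ∶ s ⇓ setArray s a (eval i s) (eval e s)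
                 in-time (1 + cost i + cost e)
  seq        : ∀ {P Q s s′ s″ t t′} →
               P ∶ s ⇓ s′ in-time t → Q ∶ s′ ⇓ s″ in-time t′ →
               (P ⨟ Q) ∶ s ⇓ s″ in-time (t + t′)
  if-nonzero : ∀ {e P Q s s′ t} → eval e s ≢ 0 → P ∶ s ⇓ s′ in-time t →
               ifNonzero e P Q ∶ s ⇓ s′ in-time (1 + cost e + t)
  if-zero    : ∀ {e P Q s s′ t} → eval e s ≡ 0 → Q ∶ s ⇓ s′ in-time t →
               ifNonzero e P Q ∶ s ⇓ s′ in-time (1 + cost e + t)
  while-step : ∀ {e P s s′ s″ t t′} → eval e s ≢ 0 → P ∶ s ⇓ s′ in-time t →
               whileNonzero e P ∶ s′ ⇓ s″ in-time t′ →
               whileNonzero e P ∶ s ⇓ s″ in-time (1 + cost e + t + t′)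
  while-stop : ∀ {e P s} → eval e s ≡ 0 →
               whileNonzero e P ∶ s ⇓ s in-time (1 + cost e)

------------------------------------------------------------------------
-- Presentation of the input

fromTable : ∀ {k} → (Fin k → ℕ) → ℕ → ℕ
fromTable {k} g i with i <? k
... | yes i<k = g (fromℕ< i<k)
... | no  _   = 0

-- Lexicographic enumeration of the points, last coordinate fastest.
coordinates : ∀ {m} d → Fin (m ^ d) → Vec (Fin m) d
coordinates         zero    _ = []
coordinates {m} (suc d) i with remQuot {m} (m ^ d) i
... | c , j = c ∷ coordinates d j

-- Registers 0 and 1 hold n and |H|.  Array 0 is the adjacency matrix of H by
-- rows.  Array 1 lists the values of f over the box in lexicographic order,
-- with 0 at interior points.  Everything else is 0.
input : ∀ d n (H : FiniteGraph) → Hom (Boundary d n) (graph H) → State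
input d n H f = ⟨ registers , arrays ⟩
  where
  entry : Fin (order H) → Fin (order H) → ℕ
  entry u v = if adj H u v then 1 else 0

  valueAt : Vec (Fin (suc n)) d → ℕ
  valueAt x with onBoundary? n x
  ... | yes b = toℕ (app f (x , [ b ]))
  ... | no  _ = 0

  registers : ℕ → ℕ
  registers 0 = n
  registers 1 = order H
  registers _ = 0

  arrays : ℕ → ℕ → ℕ
  arrays 0 = fromTable (uncurry entry ∘ remQuot {order H} (order H))
  arrays 1 = fromTable (valueAt ∘ coordinates d)
  arrays _ = λ _ → 0

-- The verdict is left in register 0.
Answers : State → Set → Set
Answers s A = (register s 0 ≡ 1 × A) ⊎ (register s 0 ≡ 0 × ¬ A)

-- Coefficients are listed from the constant term upwards.
evalPoly : List ℕ → ℕ → ℕ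
evalPoly p x = foldr (λ a r → a + x * r) 0 p

{-# OPTIONS --safe #-}
-- f extends to the box iff for every direction i and every z with zᵢ = 0 there is
-- a walk of length exactly n in H from f(z) to f(z[i≔n]).  Necessity: take the
-- image of the line.  Sufficiency: define f̃ on the interior points in order of
-- their coordinate sum, maintaining walks of length n - zᵢ from f̃(z) to f(z[i≔n])
-- for all i.  At x the value must be adjacent to the d vertices f̃(x - eᵢ) and at
-- distance at most n - xᵢ, of the right parity, from the d vertices f(x[i≔n]);
-- these 2d balls meet pairwise in the right partite class.  The program counts
-- the walks of length n by dynamic programming; the counts may be exponentially
-- large, which the cost model allows because it charges additions only.
module Submission where

open import Defs
open import Data.Bool using (Bool; true; false; if_then_else_; not; T; _∨_)
open import Data.Bool.Properties using (∨-conicalˡ; ∨-conicalʳ; not-involutive; ¬-not; not-¬; T?)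
open import Data.Empty using (⊥-elim)
open import Data.Fin as Fin using (Fin; zero; suc; toℕ; fromℕ; fromℕ<; remQuot; combine)
import Data.Fin.Properties as Fin
open import Data.Fin.Properties using (remQuot-combine; combine-remQuot)
import Data.Integer as ℤ
import Data.Integer.Properties as ℤ
open import Data.Irrelevant using ([_])
open import Data.List using (List; []; _∷_; replicate; _++_)
open import Data.Nat
open import Data.Nat.Induction using (<-rec)
open import Data.Nat.Properties
open import Data.Nat.Tactic.RingSolver using (solve-∀)
open import Data.Product using (Σ-syntax; ∃-syntax; _×_; _,_; proj₁; proj₂; uncurry)
open import Data.Refinement using (value; _,_)
open import Data.Sum using (_⊎_; inj₁; inj₂; [_,_]′)
open import Data.Unit using (tt)
open import Data.Vec using (Vec; []; _∷_; lookup; _[_]≔_; updateAt)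
open import Data.Vec.Properties
  using ([]≔-idempotent; []≔-lookup; []≔-commutes; lookup∘update; lookup∘update′; ∷-injective)
open import Data.Vec.Relation.Unary.Any using (here; there)
open import Function using (_∘_; id)
open import Level using (0ℓ)
open import Relation.Binary.PropositionalEquality
open import Relation.Nullary using (Dec; ¬_; does; yes; no; recompute)
open import Relation.Nullary.Decidable using (_×-dec_; map′; ¬?; dec-true; dec-false)
open import Relation.Unary using (Pred; Decidable)

open FiniteGraph using (order; adj; graph)

-- Program logic

-- At an interior point the only values already fixed in direction i are the lower neighbour and the
-- upper end of the line. The ball about the upper end stands in for the neighbour above, which is
-- chosen later; information about the lower end travels through the lower neighbours. This gives d
-- unit balls and d balls of radius n - xᵢ. At xᵢ = n - 1 the promised walk is a single edge, so the
-- filling joins the upper face without a separate argument.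
--
-- Walks have exact lengths, because the image of a line has one, whereas the Helly property only
-- bounds distances from above. The partite class closes this gap: it forces the defect to be even,
-- and an even defect is absorbed by going back and forth along an edge. For d = 1 there are no two
-- lower neighbours to compare, and the walk between the two ends alone makes the classes agree.
--
-- On the machine side, running time is bounded from the program text and one common bound `X` on
-- loop limits, so that loop invariants speak about values only.

writesReg : ℕ → Program → Bool
writesReg r skip                = false
writesReg r (q ≔ _)             = does (r ≟ q)
writesReg r (_ at _ ≔ _)        = false
writesReg r (P ⨟ Q)             = writesReg r P ∨ writesReg r Q
writesReg r (ifNonzero _ P Q)   = writesReg r P ∨ writesReg r Q
writesReg r (whileNonzero _ P)  = writesReg r P

writesArr : ℕ → Program → Bool
writesArr a skip                = false
writesArr a (_ ≔ _)             = false
writesArr a (b at _ ≔ _)        = does (a ≟ b)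
writesArr a (P ⨟ Q)             = writesArr a P ∨ writesArr a Q
writesArr a (ifNonzero _ P Q)   = writesArr a P ∨ writesArr a Q
writesArr a (whileNonzero _ P)  = writesArr a P

-- Writing is decided syntactically, so for a concrete program each premise computes and `refl`
-- proves it. Only `power k`, whose text depends on `k`, needs lemmas of its own.
record Frame (P : Program) (s s′ : State) : Set where
  constructor frame
  field
    keepsReg : ∀ r → writesReg r P ≡ false → register s′ r ≡ register s r
    keepsArr : ∀ a → writesArr a P ≡ false → array s′ a ≡ array s a

open Frame

update-other : {A : Set} (g : ℕ → A) {i j : ℕ} {x : A} →
               does (j ≟ i) ≡ false → (g [ i ↦ x ]) j ≡ g j
update-other g p rewrite p = refl

update-same : {A : Set} (g : ℕ → A) (i : ℕ) {x : A} → (g [ i ↦ x ]) i ≡ x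
update-same g i rewrite dec-true (i ≟ i) refl = refl

exec-frame : ∀ {P s s′ t} → P ∶ s ⇓ s′ in-time t → Frame P s s′
exec-frame D = frame (λ r → regs D r) (λ a → arrs D a)
  where
  regs : ∀ {P s s′ t} → P ∶ s ⇓ s′ in-time t →
         ∀ r → writesReg r P ≡ false → register s′ r ≡ register s r
  regs skip r p = refl
  regs (assign {s}) r p = update-other (register s) p
  regs store r p = refl
  regs (seq D E) r p = trans (regs E r (∨-conicalʳ _ _ p)) (regs D r (∨-conicalˡ _ _ p))
  regs (if-nonzero _ D) r p = regs D r (∨-conicalˡ _ _ p)
  regs (if-zero {P = P} _ D) r p = regs D r (∨-conicalʳ (writesReg r P) _ p)
  regs (while-step _ D E) r p = trans (regs E r p) (regs D r p)
  regs (while-stop _) r p = refl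

  arrs : ∀ {P s s′ t} → P ∶ s ⇓ s′ in-time t →
         ∀ a → writesArr a P ≡ false → array s′ a ≡ array s a
  arrs skip a p = refl
  arrs assign a p = refl
  arrs (store {s}) a p = update-other (array s) p
  arrs (seq D E) a p = trans (arrs E a (∨-conicalʳ _ _ p)) (arrs D a (∨-conicalˡ _ _ p))
  arrs (if-nonzero _ D) a p = arrs D a (∨-conicalˡ _ _ p)
  arrs (if-zero {P = P} _ D) a p = arrs D a (∨-conicalʳ (writesArr a P) _ p)
  arrs (while-step _ D E) a p = trans (arrs E a p) (arrs D a p)
  arrs (while-stop _) a p = refl

-- Bounds the running time of P when no loop makes more than X iterations.
bound : Program → ℕ → ℕ
bound skip               X = 1
bound (_ ≔ e)            X = 1 + cost e
bound (_ at i ≔ e)       X = 1 + cost i + cost e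
bound (P ⨟ Q)            X = bound P X + bound Q X
bound (ifNonzero e P Q)  X = 1 + cost e + (bound P X + bound Q X)
bound (whileNonzero e P) X = 1 + cost e + X * (1 + cost e + bound P X)

-- Running times as polynomials

addPoly : List ℕ → List ℕ → List ℕ
addPoly []      q       = q
addPoly (a ∷ p) []      = a ∷ p
addPoly (a ∷ p) (b ∷ q) = a + b ∷ addPoly p q

evalPoly-add : ∀ p q x → evalPoly (addPoly p q) x ≡ evalPoly p x + evalPoly q x
evalPoly-add []      q       x = refl
evalPoly-add (a ∷ p) []      x = sym (+-identityʳ _)
evalPoly-add (a ∷ p) (b ∷ q) x rewrite evalPoly-add p q x =
  lemma a b x (evalPoly p x) (evalPoly q x)
  where
  lemma : ∀ a b x y z → a + b + x * (y + z) ≡ (a + x * y) + (b + x * z)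
  lemma = solve-∀

evalPoly-shift : ∀ d p x → evalPoly (replicate d 0 ++ p) x ≡ x ^ d * evalPoly p x
evalPoly-shift zero    p x = sym (+-identityʳ _)
evalPoly-shift (suc d) p x rewrite evalPoly-shift d p x = sym (*-assoc x (x ^ d) _)

evalPoly-const : ∀ c x → evalPoly (c ∷ []) x ≡ c
evalPoly-const c x = trans (cong (c +_) (*-zeroʳ x)) (+-identityʳ c)

module _ (d : ℕ) where

  -- With `x ^ d` as the bound on iterations, a loop multiplies the cost of one round by `x ^ d`,
  -- which shifts the coefficients by `d` places.
  timePoly : Program → List ℕ
  timePoly skip               = 1 ∷ []
  timePoly (_ ≔ e)            = 1 + cost e ∷ []
  timePoly (_ at i ≔ e)       = 1 + cost i + cost e ∷ []
  timePoly (P ⨟ Q)            = addPoly (timePoly P) (timePoly Q)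
  timePoly (ifNonzero e P Q)  =
    addPoly (1 + cost e ∷ []) (addPoly (timePoly P) (timePoly Q))
  timePoly (whileNonzero e P) =
    addPoly (1 + cost e ∷ []) (replicate d 0 ++ addPoly (1 + cost e ∷ []) (timePoly P))

  evalPoly-time : ∀ P x → evalPoly (timePoly P) x ≡ bound P (x ^ d)
  evalPoly-time skip               x = evalPoly-const 1 x
  evalPoly-time (_ ≔ e)            x = evalPoly-const (1 + cost e) x
  evalPoly-time (_ at i ≔ e)       x = evalPoly-const (1 + cost i + cost e) x
  evalPoly-time (P ⨟ Q)            x =
    trans (evalPoly-add (timePoly P) (timePoly Q) x)
          (cong₂ _+_ (evalPoly-time P x) (evalPoly-time Q x))
  evalPoly-time (ifNonzero e P Q)  x =
    trans (evalPoly-add (1 + cost e ∷ []) (addPoly (timePoly P) (timePoly Q)) x)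
          (cong₂ _+_ (evalPoly-const (1 + cost e) x)
            (trans (evalPoly-add (timePoly P) (timePoly Q) x)
                   (cong₂ _+_ (evalPoly-time P x) (evalPoly-time Q x))))
  evalPoly-time (whileNonzero e P) x =
    trans (evalPoly-add (1 + cost e ∷ []) (replicate d 0 ++ body) x)
      (cong₂ _+_ (evalPoly-const (1 + cost e) x)
        (trans (evalPoly-shift d body x) (cong (x ^ d *_)
          (trans (evalPoly-add (1 + cost e ∷ []) (timePoly P) x)
            (cong₂ _+_ (evalPoly-const (1 + cost e) x) (evalPoly-time P x))))))
    where body = addPoly (1 + cost e ∷ []) (timePoly P)

-- Total correctness with time bounds

forUp : (counter limit : ℕ) → Program → Program
forUp c l body =
  (c ≔ lit 0) ⨟ whileNonzero (reg l ⊖ reg c) (body ⨟ (c ≔ (reg c ⊕ lit 1)))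

module Logic (X : ℕ) where

  -- The time bound depends on the program text alone, so it composes automatically; specifications
  -- of programs mention time only by asking that loop limits be at most `X`.
  record Runs (P : Program) (s : State) (Q : State → Set) : Set where
    constructor runs
    field
      {final} : State
      {time}  : ℕ
      exec    : P ∶ s ⇓ final in-time time
      fast    : time ≤ bound P X
      post    : Q final

  open Runs public

  run-skip : ∀ {s Q} → Q s → Runs skip s Q
  run-skip q = runs skip ≤-refl q

  run-assign : ∀ {s r e Q} → Q (setRegister s r (eval e s)) → Runs (r ≔ e) s Q
  run-assign q = runs assign ≤-refl q

  run-assign-then : ∀ {s r e P Q} → Runs P (setRegister s r (eval e s)) Q → Runs ((r ≔ e) ⨟ P) s Q
  run-assign-then (runs D t≤ q) = runs (seq assign D) (+-monoʳ-≤ _ t≤) q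

  run-store : ∀ {s a i e Q} → Q (setArray s a (eval i s) (eval e s)) → Runs (a at i ≔ e) s Q
  run-store q = runs store ≤-refl q

  weaken : ∀ {P s Q Q′} → Runs P s Q → (∀ s′ → Frame P s s′ → Q s′ → Q′ s′) → Runs P s Q′
  weaken (runs D t≤ q) f = runs D t≤ (f _ (exec-frame D) q)

  infixr 4 _then_

  _then_ : ∀ {P P′ s R Q} → Runs P s R →
           (∀ s′ → Frame P s s′ → R s′ → Runs P′ s′ Q) → Runs (P ⨟ P′) s Q
  runs D t≤ r then k with k _ (exec-frame D) r
  ... | runs D′ t′≤ q = runs (seq D D′) (+-mono-≤ t≤ t′≤) q

  run-if : ∀ {e P P′ s Q} → (eval e s ≢ 0 → Runs P s Q) → (eval e s ≡ 0 → Runs P′ s Q) →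
           Runs (ifNonzero e P P′) s Q
  run-if {e} {P} {P′} {s} f g with eval e s ≟ 0
  ... | yes p with g p
  ...   | runs D t≤ q =
          runs (if-zero p D) (+-monoʳ-≤ (1 + cost e) (≤-trans t≤ (m≤n+m _ (bound P X)))) q
  run-if {e} {P} {P′} {s} f g | no p with f p
  ...   | runs D t≤ q =
          runs (if-nonzero p D) (+-monoʳ-≤ (1 + cost e) (≤-trans t≤ (m≤m+n _ (bound P′ X)))) q

  -- The step receives a frame reaching back to the state before the loop, so an invariant has to
  -- mention only what the loop changes. The stability premise covers the writes to the counter,
  -- which happen outside `body`.
  run-forUp : ∀ c l body N {s} (I : ℕ → State → Set) →
              does (l ≟ c) ≡ false → writesReg c body ≡ false → writesReg l body ≡ false →
              (∀ j s′ v → I j s′ → I j (setRegister s′ c v)) →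
              register s l ≡ N → N ≤ X → I 0 s →
              (∀ j s′ → j < N → register s′ c ≡ j → Frame (forUp c l body) s s′ →
                I j s′ → Runs body s′ (I (suc j))) →
              Runs (forUp c l body) s (I N)
  run-forUp c l body N {s} I l≢c c∉ l∉ stable limit N≤X start step =
    let s″ , t , D , t≤ , q = loop N 0 (+-identityʳ N) s₁
                                (update-same (register s) c) F₁ (stable 0 s 0 start)
    in runs (seq assign D)
            (+-monoʳ-≤ 2 (≤-trans t≤
              (+-monoʳ-≤ (1 + cost e) (*-monoˡ-≤ (1 + cost e + bound body′ X) N≤X)))) q
    where
    e = reg l ⊖ reg c
    incr = c ≔ (reg c ⊕ lit 1)
    body′ = body ⨟ incr
    s₁ = setRegister s c 0

    F₁ : Frame (forUp c l body) s s₁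
    F₁ = frame (λ r p → update-other (register s) (∨-conicalˡ _ _ p)) (λ _ _ → refl)

    advance : ∀ {s′ s″} → Frame (forUp c l body) s s′ → Frame body′ s′ s″ →
              Frame (forUp c l body) s s″
    advance F G = frame
      (λ r p → trans (keepsReg G r (∨-conicalʳ (does (r ≟ c)) _ p)) (keepsReg F r p))
      (λ a p → trans (keepsArr G a p) (keepsArr F a p))

    l∉loop : writesReg l (forUp c l body) ≡ false
    l∉loop rewrite l≢c | l∉ = refl

    loop : ∀ k j → k + j ≡ N → ∀ s′ → register s′ c ≡ j → Frame (forUp c l body) s s′ → I j s′ →
           Σ[ s″ ∈ State ] Σ[ t ∈ ℕ ] (whileNonzero e body′ ∶ s′ ⇓ s″ in-time t
             × t ≤ 1 + cost e + k * (1 + cost e + bound body′ X) × I N s″)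
    loop zero j refl s′ at-j F i =
      s′ , _ , while-stop stops , ≤-reflexive (sym (+-identityʳ (1 + cost e))) , i
      where
      stops : register s′ l ∸ register s′ c ≡ 0
      stops rewrite keepsReg F l l∉loop | limit | at-j = n∸n≡0 j
    loop (suc k) j k+j s′ at-j F i with step j s′ (subst (j <_) k+j (s≤s (m≤n+m j k))) at-j F i
    ... | runs {s₂} {t₂} D t₂≤ i₂ =
      let s₃ = setRegister s₂ c (register s₂ c + 1)
          -- The 4 is the cost of `incr`; a loop test happens to cost 4 as well.
          E : body′ ∶ s′ ⇓ s₃ in-time (t₂ + 4)
          E = seq D assign
          at-1+j : register s₃ c ≡ suc j
          at-1+j = trans (update-same (register s₂) c)
                     (trans (cong (_+ 1) (trans (keepsReg (exec-frame D) c c∉) at-j)) (+-comm j 1))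
          s″ , t , L , t≤ , q = loop k (suc j) (trans (+-suc k j) k+j) s₃ at-1+j
                                  (advance F (exec-frame E)) (stable (suc j) s₂ _ i₂)
      in s″ , _ , while-step goes E L , total k t₂ t t₂≤ t≤ , q
      where
      goes : register s′ l ∸ register s′ c ≢ 0
      goes rewrite keepsReg F l l∉loop | limit | at-j | sym k+j | m+n∸n≡m (suc k) j = λ ()

      total : ∀ k t₂ t → t₂ ≤ bound body X → t ≤ 1 + cost e + k * (1 + cost e + bound body′ X) →
              1 + cost e + (t₂ + 4) + t
              ≤ 1 + cost e + (1 + cost e + bound body′ X + k * (1 + cost e + bound body′ X))
      total k t₂ t t₂≤ t≤ = ≤-trans (+-mono-≤ (+-monoʳ-≤ (1 + cost e) (+-monoˡ-≤ 4 t₂≤)) t≤)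
        (≤-reflexive (lemma (bound body X + 4) (k * (1 + cost e + bound body′ X))))
        where
        lemma : ∀ b r → 4 + b + (4 + r) ≡ 4 + (4 + b + r)
        lemma = solve-∀

polynomialTime : ∀ d P x {s Q} → Logic.Runs (x ^ d) P s Q →
                 Σ[ s′ ∈ State ] Σ[ t ∈ ℕ ]
                   (P ∶ s ⇓ s′ in-time t × t ≤ evalPoly (timePoly d P) x × Q s′)
polynomialTime d P x (Logic.runs D t≤ q) =
  _ , _ , D , ≤-trans t≤ (≤-reflexive (sym (evalPoly-time d P x))) , q

-- Counting walks along all lines

sumTo : ℕ → (ℕ → ℕ) → ℕ
sumTo zero    f = 0
sumTo (suc k) f = sumTo k f + f k

sumTo-cong : ∀ k {f g : ℕ → ℕ} → (∀ i → i < k → f i ≡ g i) → sumTo k f ≡ sumTo k g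
sumTo-cong zero    eq = refl
sumTo-cong (suc k) eq =
  cong₂ _+_ (sumTo-cong k λ i i<k → eq i (m<n⇒m<1+n i<k)) (eq k ≤-refl)

-- Multiplication by a 0/1 matrix entry, in the form of the conditional that `addEntry` executes,
-- since the machine cannot multiply.
gate : ℕ → ℕ → ℕ
gate zero    y = 0
gate (suc _) y = y

-- The number of walks of length k from v to t in the graph on {0,…,m-1} with
-- adjacency matrix a.
walks : (a : ℕ → ℕ) (m t : ℕ) → ℕ → ℕ → ℕ
walks a m t zero    v = 1 ∸ ((v ∸ t) + (t ∸ v))
walks a m t (suc k) v = sumTo m λ u → gate (a (v * m + u)) (walks a m t k u)

update-extends : ∀ {g w : ℕ → ℕ} {i j x} → i ≡ j → x ≡ w j → (∀ k → k < j → g k ≡ w k) →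
                 ∀ k → k < suc j → (g [ i ↦ x ]) k ≡ w k
update-extends {g} {w} {i} refl refl eq k k<1+j with m≤n⇒m<n∨m≡n (≤-pred k<1+j)
... | inj₁ k<j  = trans (update-other g (dec-false (k ≟ i) (<⇒≢ k<j))) (eq k k<j)
... | inj₂ refl = update-same g k

-- Registers: 0 = n, 1 = |H|, 3 = number of missing walks, 4 = number of blocks,
-- 5 = stride S, 6 = n S, 7 = position, 8–12 and 18 = counters, 13 = sum,
-- 14 = position in the matrix, 15 = target, 16 = result of power, 17 = scratch.
-- Array 2 holds the numbers of walks to the target, array 3 those of the next length.
power : ℕ → Program
power zero    = 16 ≔ lit 1
power (suc k) = power k ⨟ ((17 ≔ reg 16) ⨟ forUp 18 0 (16 ≔ (reg 16 ⊕ reg 17)))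

-- One target is fixed, so a round is a matrix-vector product. `initialise` stores the Kronecker
-- delta: the two truncated differences add up to |v - t|. Register 14 sweeps the matrix linearly,
-- which replaces the product in v |H| + u. Array 3 buffers a round because every new count may use
-- all the old ones.
initialise addEntry sumRow copyRow advanceRound countWalks checkLine : Program
initialise = forUp 11 1
  (2 at reg 11 ≔ (lit 1 ⊖ ((reg 11 ⊖ reg 15) ⊕ (reg 15 ⊖ reg 11))))
addEntry = ifNonzero (0 at reg 14) (13 ≔ (reg 13 ⊕ (2 at reg 12))) skip ⨟ (14 ≔ (reg 14 ⊕ lit 1))
sumRow = (13 ≔ lit 0) ⨟ (forUp 12 1 addEntry ⨟ (3 at reg 11 ≔ reg 13))
copyRow = 2 at reg 11 ≔ (3 at reg 11)
advanceRound = (14 ≔ lit 0) ⨟ (forUp 11 1 sumRow ⨟ forUp 11 1 copyRow)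
countWalks = initialise ⨟ forUp 10 0 advanceRound
checkLine = (15 ≔ (1 at (reg 7 ⊕ reg 6))) ⨟
  (countWalks ⨟ (3 ≔ (reg 3 ⊕ (lit 1 ⊖ (2 at (1 at reg 7))))))

-- A block of (n+1) S consecutive positions begins with the S starting points of its lines, and
-- their far ends lie n S positions later. The jump by register 6 after a block therefore leads to
-- the first position of the next.
checkBlock checkLines : Program
checkBlock = forUp 9 5 (checkLine ⨟ (7 ≔ (reg 7 ⊕ lit 1)))
checkLines = (6 ≔ lit 0) ⨟ (forUp 10 0 (6 ≔ (reg 6 ⊕ reg 5)) ⨟ ((7 ≔ lit 0) ⨟
  forUp 8 4 (checkBlock ⨟ (7 ≔ (reg 7 ⊕ reg 6)))))

-- The direction with j coordinates before it and k after it: its lines start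
-- at A (n+1) S + B with A < (n+1)^j and B < S = (n+1)^k.
checkDirection : ℕ → ℕ → Program
checkDirection j k = power j ⨟ ((4 ≔ reg 16) ⨟ (power k ⨟ ((5 ≔ reg 16) ⨟ checkLines)))

-- The sum of the arguments is kept by the recursion, so from `d` and `0` it reaches exactly the
-- pairs with j + k + 1 = d, one for each coordinate.
checkDirections : ℕ → ℕ → Program
checkDirections zero    k = skip
checkDirections (suc j) k = checkDirections j (suc k) ⨟ checkDirection j k

holeFilling : ℕ → Program
holeFilling d = checkDirections d 0 ⨟ (0 ≔ (lit 1 ⊖ reg 3))

-- `power 1` already writes every register that any power writes, so one computable test serves all
-- `k`.
power-frame : ∀ r k → writesReg r (power 1) ≡ false → writesReg r (power k) ≡ false
power-frame r zero    p = ∨-conicalˡ _ _ p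
power-frame r (suc k) p rewrite power-frame r k p = ∨-conicalʳ (does (r ≟ 16)) _ p

power-arr : ∀ a k → writesArr a (power k) ≡ false
power-arr a zero    = refl
power-arr a (suc k) rewrite power-arr a k = refl

module _ (X : ℕ) where
  open Logic X

  module _ (n : ℕ) (n≤X : n ≤ X) where

    power-spec : ∀ k {s} → register s 0 ≡ n → Runs (power k) s (λ s′ → register s′ 16 ≡ suc n ^ k)
    power-spec zero    r₀ = run-assign refl
    power-spec (suc k) {s} r₀ =
      power-spec k r₀ then λ s₁ F₁ T → run-assign-then (
      -- Register 16 enters the loop holding one copy of the previous power, so `n` additions leave
      -- n + 1 copies.
      run-forUp 18 0 _ n (λ j s′ → register s′ 16 ≡ suc j * suc n ^ k)
        refl refl refl (λ _ _ _ p → p)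
        (trans (keepsReg F₁ 0 (power-frame 0 k refl)) r₀) n≤X
        (trans T (sym (+-identityʳ _)))
        λ j s₃ _ _ F₃ p → run-assign
          (trans (cong₂ _+_ p (trans (keepsReg F₃ 17 refl) T)) (+-comm (suc j * suc n ^ k) _)))

  module _ (a : ℕ → ℕ) (n m t : ℕ) (n≤X : n ≤ X) (m≤X : m ≤ X) (t<m : t < m) where

    Row : ℕ → ℕ → State → Set
    Row arr k s = ∀ i → i < m → array s arr i ≡ walks a m t k i

    initialise-spec : ∀ {s} → register s 1 ≡ m → register s 15 ≡ t →
                      Runs initialise s (Row 2 0)
    initialise-spec r₁ r₁₅ =
      run-forUp 11 1 _ m (λ j s → ∀ i → i < j → array s 2 i ≡ walks a m t 0 i)
        refl refl refl (λ _ _ _ p → p) r₁ m≤X (λ _ ())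
        λ j s _ at-j F p → run-store (update-extends at-j
          (cong₂ (λ v t → 1 ∸ ((v ∸ t) + (t ∸ v))) at-j (trans (keepsReg F 15 refl) r₁₅)) p)

    module _ (k : ℕ) where

      term : ℕ → ℕ → ℕ
      term v u = gate (a (v * m + u)) (walks a m t k u)

      addEntry-spec : ∀ v u {s} → array s 0 ≡ a → register s 12 ≡ u →
                      array s 2 u ≡ walks a m t k u →
                      register s 13 ≡ sumTo u (term v) → register s 14 ≡ v * m + u →
                      Runs addEntry s (λ s′ → register s′ 13 ≡ sumTo (suc u) (term v)
                                            × register s′ 14 ≡ v * m + suc u)
      addEntry-spec v u {s} a₀ r₁₂ row acc pos =
        run-if {Q = λ s′ → register s′ 13 ≡ sumTo (suc u) (term v)}
          (λ nz → run-assign (cong₂ _+_ acc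
                    (trans (cong (array s 2) r₁₂) (trans row (sym (gate-on nz))))))
          (λ z → run-skip (trans acc
                   (sym (trans (cong (sumTo u (term v) +_) (gate-off z)) (+-identityʳ _)))))
        then λ s₁ F p → run-assign
          (p , trans (cong (_+ 1) (trans (keepsReg F 14 refl) pos))
                     (trans (+-assoc (v * m) u 1) (cong (v * m +_) (+-comm u 1))))
        where
        entry≡ : eval (0 at reg 14) s ≡ a (v * m + u)
        entry≡ = trans (cong (array s 0) pos) (cong (λ f → f (v * m + u)) a₀)

        gate-on : eval (0 at reg 14) s ≢ 0 → term v u ≡ walks a m t k u
        gate-on nz with a (v * m + u) | entry≡
        ... | zero  | q = ⊥-elim (nz q)
        ... | suc _ | q = refl

        gate-off : eval (0 at reg 14) s ≡ 0 → term v u ≡ 0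
        gate-off z with a (v * m + u) | trans (sym entry≡) z
        ... | zero  | refl = refl

      sumRow-spec : ∀ v {s} → register s 1 ≡ m → array s 0 ≡ a → Row 2 k s →
                    register s 11 ≡ v → register s 14 ≡ v * m →
                    (∀ i → i < v → array s 3 i ≡ walks a m t (suc k) i) →
                    Runs sumRow s (λ s′ → (∀ i → i < suc v → array s′ 3 i ≡ walks a m t (suc k) i)
                                        × register s′ 14 ≡ suc v * m)
      sumRow-spec v {s} r₁ a₀ row at-v pos done = run-assign-then (
        run-forUp 12 1 _ m (λ j s′ → register s′ 13 ≡ sumTo j (term v) × register s′ 14 ≡ v * m + j)
          refl refl refl (λ _ _ _ p → p) r₁ m≤X (refl , trans pos (sym (+-identityʳ _)))
          (λ u s₁ u<m at-u F (acc , pos′) →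
            addEntry-spec v u (trans (keepsArr F 0 refl) a₀) at-u
              (trans (cong (λ f → f u) (keepsArr F 2 refl)) (row u u<m)) acc pos′)
        then λ s₁ F (acc , pos′) → run-store
          (update-extends (trans (keepsReg F 11 refl) at-v) acc
             (λ i i<v → trans (cong (λ f → f i) (keepsArr F 3 refl)) (done i i<v))
          , trans pos′ (+-comm (v * m) m)))

      advanceRound-spec : ∀ {s} → register s 1 ≡ m → array s 0 ≡ a → Row 2 k s →
                          Runs advanceRound s (Row 2 (suc k))
      advanceRound-spec {s} r₁ a₀ row = run-assign-then (
        run-forUp 11 1 _ m (λ j s′ → (∀ i → i < j → array s′ 3 i ≡ walks a m t (suc k) i)
                                   × register s′ 14 ≡ j * m)
          refl refl refl (λ _ _ _ p → p) r₁ m≤X ((λ _ ()) , refl)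
          (λ v s₁ v<m at-v F (done , pos) →
            sumRow-spec v (trans (keepsReg F 1 refl) r₁) (trans (keepsArr F 0 refl) a₀)
              (λ i i<m → trans (cong (λ f → f i) (keepsArr F 2 refl)) (row i i<m)) at-v pos done)
        then λ s₁ F₁ (done , _) →
        run-forUp 11 1 _ m (λ j s′ → ∀ i → i < j → array s′ 2 i ≡ walks a m t (suc k) i)
          refl refl refl (λ _ _ _ p → p) (trans (keepsReg F₁ 1 refl) r₁) m≤X (λ _ ())
          λ v s₂ v<m at-v F₂ copied → run-store (update-extends at-v
            (trans (cong (array s₂ 3) at-v)
              (trans (cong (λ f → f v) (keepsArr F₂ 3 refl)) (done v v<m))) copied))

    countWalks-spec : ∀ {s} → register s 0 ≡ n → register s 1 ≡ m → array s 0 ≡ a →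
                      register s 15 ≡ t → Runs countWalks s (Row 2 n)
    countWalks-spec r₀ r₁ a₀ r₁₅ =
      initialise-spec r₁ r₁₅ then λ s₁ F₁ row₀ →
      run-forUp 10 0 _ n (Row 2) refl refl refl (λ _ _ _ p → p)
        (trans (keepsReg F₁ 0 refl) r₀) n≤X row₀
        λ k s₂ _ _ F₂ row → advanceRound-spec k
          (trans (keepsReg F₂ 1 refl) (trans (keepsReg F₁ 1 refl) r₁))
          (trans (keepsArr F₂ 0 refl) (trans (keepsArr F₁ 0 refl) a₀)) row

  module Check (a f : ℕ → ℕ) (n m : ℕ) (n≤X : n ≤ X) (m≤X : m ≤ X) (f<m : ∀ p → f p < m) where

    Known : State → Set
    Known s = register s 0 ≡ n × register s 1 ≡ m × array s 0 ≡ a × array s 1 ≡ f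

    known-frame : ∀ {P s s′} → Frame P s s′ → writesReg 0 P ≡ false → writesReg 1 P ≡ false →
                  writesArr 0 P ≡ false → writesArr 1 P ≡ false → Known s → Known s′
    known-frame F p₀ p₁ q₀ q₁ (r₀ , r₁ , a₀ , a₁) =
      trans (keepsReg F 0 p₀) r₀ , trans (keepsReg F 1 p₁) r₁ ,
      trans (keepsArr F 0 q₀) a₀ , trans (keepsArr F 1 q₁) a₁

    -- An indicator with values 0 and 1: truncated subtraction sends every positive count to 0.
    miss : ℕ → ℕ → ℕ
    miss off p = 1 ∸ walks a m (f (p + off)) n (f p)

    checkLine-spec : ∀ {s} p off → Known s → register s 7 ≡ p → register s 6 ≡ off →
                     Runs checkLine s (λ s′ → register s′ 3 ≡ register s 3 + miss off p)
    checkLine-spec {s} p off (r₀ , r₁ , a₀ , a₁) r₇ r₆ = run-assign-then (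
      countWalks-spec a n m (f (p + off)) n≤X m≤X (f<m (p + off)) r₀ r₁ a₀
        (cong₂ (λ g i → g i) a₁ (cong₂ _+_ r₇ r₆))
      then λ s₁ F row → run-assign (cong₂ _+_ (keepsReg F 3 refl)
        (cong (1 ∸_) (trans (cong (array s₁ 2) (cong₂ (λ g i → g i)
                              (trans (keepsArr F 1 refl) a₁) (trans (keepsReg F 7 refl) r₇)))
                            (row (f p) (f<m p))))))

    checkBlock-spec : ∀ {s} p off S → S ≤ X → Known s → register s 5 ≡ S →
                      register s 6 ≡ off → register s 7 ≡ p →
                      Runs checkBlock s (λ s′ →
                        register s′ 3 ≡ register s 3 + sumTo S (λ b → miss off (p + b))
                        × register s′ 7 ≡ p + S)
    checkBlock-spec {s} p off S S≤X K r₅ r₆ r₇ =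
      run-forUp 9 5 _ S (λ j s′ → register s′ 3 ≡ register s 3 + sumTo j (λ b → miss off (p + b))
                                × register s′ 7 ≡ p + j)
        refl refl refl (λ _ _ _ q → q) r₅ S≤X
        (sym (+-identityʳ _) , trans r₇ (sym (+-identityʳ p)))
        λ b s₁ _ _ F₁ (bad , pos) →
          checkLine-spec (p + b) off (known-frame F₁ refl refl refl refl K) pos
            (trans (keepsReg F₁ 6 refl) r₆)
          then λ s₂ F₂ bad′ → run-assign
            ( trans bad′ (trans (cong (_+ miss off (p + b)) bad) (+-assoc (register s 3) _ _))
            , trans (cong (_+ 1) (trans (keepsReg F₂ 7 refl) pos))
                    (trans (+-assoc p b 1) (cong (p +_) (+-comm b 1))))

    -- The block length appears as `S + n * S` because `suc n ^ suc l` unfolds to this when `S` is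
    -- `suc n ^ l`.
    missIn : ℕ → ℕ → ℕ
    missIn A S = sumTo A λ i → sumTo S λ b → miss (n * S) (i * (S + n * S) + b)

    checkLines-spec : ∀ {s} A S → A ≤ X → S ≤ X → Known s → register s 4 ≡ A → register s 5 ≡ S →
                      Runs checkLines s (λ s′ → register s′ 3 ≡ register s 3 + missIn A S)
    checkLines-spec {s} A S A≤X S≤X K r₄ r₅ = run-assign-then (
      run-forUp 10 0 _ n (λ j s′ → register s′ 6 ≡ j * S) refl refl refl (λ _ _ _ q → q)
        (proj₁ K) n≤X refl
        (λ j s₁ _ _ F₁ p →
          run-assign (trans (cong₂ _+_ p (trans (keepsReg F₁ 5 refl) r₅)) (+-comm (j * S) S)))
      then λ s₂ F₂ r₆ → run-assign-then (
      weaken (run-forUp 8 4 _ A (λ j s′ →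
          register s′ 3 ≡ register s₂ 3 +
            (sumTo j λ i → sumTo S λ b → miss (n * S) (i * (S + n * S) + b))
          × register s′ 7 ≡ j * (S + n * S))
        refl refl refl (λ _ _ _ q → q) (trans (keepsReg F₂ 4 refl) r₄) A≤X
        (sym (+-identityʳ _) , refl)
        λ j s₃ _ _ F₃ (bad , pos) →
          checkBlock-spec (j * (S + n * S)) (n * S) S S≤X
            (known-frame F₃ refl refl refl refl (known-frame F₂ refl refl refl refl K))
            (trans (keepsReg F₃ 5 refl) (trans (keepsReg F₂ 5 refl) r₅))
            (trans (keepsReg F₃ 6 refl) r₆) pos
          then λ s₄ F₄ (bad′ , pos′) → run-assign
            ( trans bad′ (trans (cong (_+ _) bad) (+-assoc (register s₂ 3) _ _))
            , trans (cong₂ _+_ pos′ (trans (keepsReg F₄ 6 refl) (trans (keepsReg F₃ 6 refl) r₆)))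
                    (trans (+-assoc (j * (S + n * S)) S (n * S)) (+-comm (j * (S + n * S)) _))))
        λ s₅ _ (bad , _) → trans bad (cong (_+ missIn A S) (keepsReg F₂ 3 refl))))

    missAlong : ℕ → ℕ → ℕ
    missAlong j k = missIn (suc n ^ j) (suc n ^ k)

    missTotal : ℕ → ℕ → ℕ
    missTotal zero    k = 0
    missTotal (suc j) k = missTotal j (suc k) + missAlong j k

    module _ (d : ℕ) (powers≤X : ∀ i → i ≤ d → suc n ^ i ≤ X) where

      checkDirection-spec : ∀ {s} j k → j ≤ d → k ≤ d → Known s →
        Runs (checkDirection j k) s (λ s′ → register s′ 3 ≡ register s 3 + missAlong j k)
      checkDirection-spec {s} j k j≤d k≤d K =
        power-spec n n≤X j (proj₁ K) then λ s₁ F₁ A → run-assign-then (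
        power-spec n n≤X k (trans (keepsReg F₁ 0 (power-frame 0 j refl)) (proj₁ K))
        then λ s₂ F₂ S → run-assign-then (
        weaken (checkLines-spec (suc n ^ j) (suc n ^ k) (powers≤X j j≤d) (powers≤X k k≤d)
          (frames k F₂ (frames j F₁ K))
          (trans (keepsReg F₂ 4 (power-frame 4 k refl)) A) S)
        λ s₃ _ bad → trans bad (cong (_+ missAlong j k)
          (trans (keepsReg F₂ 3 (power-frame 3 k refl)) (keepsReg F₁ 3 (power-frame 3 j refl))))))
        where
        frames : ∀ i {s s′} → Frame (power i) s s′ → Known s → Known s′
        frames i F = known-frame F (power-frame 0 i refl) (power-frame 1 i refl)
                                   (power-arr 0 i) (power-arr 1 i)

      checkDirections-spec : ∀ {s} j k → j + k ≤ d → Known s →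
        Runs (checkDirections j k) s
             (λ s′ → register s′ 3 ≡ register s 3 + missTotal j k × Known s′)
      checkDirections-spec zero    k _    K = run-skip (sym (+-identityʳ _) , K)
      checkDirections-spec {s} (suc j) k j+k≤d K =
        checkDirections-spec j (suc k) (subst (_≤ d) (sym (+-suc j k)) j+k≤d) K
        then λ s₁ F₁ (bad , K₁) → weaken (checkDirection-spec j k
          (≤-trans (m≤n⇒m≤1+n (m≤m+n j k)) j+k≤d) (≤-trans (m≤n+m k (suc j)) j+k≤d) K₁)
        λ s₂ F₂ bad₂ → trans bad₂ (trans (cong (_+ missAlong j k) bad) (+-assoc (register s 3) _ _))
          , known-frame F₂ (none 0 refl refl) (none 1 refl refl)
                           (noneArr 0 refl) (noneArr 1 refl) K₁
        where
        -- The second premise concerns the program with both powers cut out; what is left is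
        -- concrete, so `refl` proves it.
        none : ∀ r → writesReg r (power 1) ≡ false →
               writesReg r ((4 ≔ lit 0) ⨟ ((5 ≔ lit 0) ⨟ checkLines)) ≡ false →
               writesReg r (checkDirection j k) ≡ false
        none r p q rewrite power-frame r j p | power-frame r k p = q

        noneArr : ∀ a → writesArr a checkLines ≡ false →
                  writesArr a (checkDirection j k) ≡ false
        noneArr a q rewrite power-arr a j | power-arr a k = q

      holeFilling-spec : ∀ {s} → Known s → register s 3 ≡ 0 →
        Runs (checkDirections d 0 ⨟ (0 ≔ (lit 1 ⊖ reg 3))) s
             (λ s′ → register s′ 0 ≡ 1 ∸ missTotal d 0)
      holeFilling-spec K r₃ =
        checkDirections-spec d 0 (≤-reflexive (+-identityʳ d)) K
        then λ s₁ F₁ (bad , _) → run-assign (cong (1 ∸_) (trans bad (cong (_+ missTotal d 0) r₃)))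

-- Walks and the Helly property

module _ {G : Graph} where

  infixr 5 _++ʷ_

  _++ʷ_ : ∀ {u v w j k} → Walk G u v j → Walk G v w k → Walk G u w (j + k)
  []      ++ʷ W = W
  (e ∷ V) ++ʷ W = e ∷ (V ++ʷ W)

  snoc : ∀ {u v w k} → Walk G u v k → G ⊢ v ~ w → Walk G u w (suc k)
  snoc []      e = e ∷ []
  snoc (d ∷ W) e = d ∷ snoc W e

  reverseʷ : ∀ {u v k} → Walk G u v k → Walk G v u k
  reverseʷ []      = []
  reverseʷ (e ∷ W) = snoc (reverseʷ W) (Graph.~-sym G e)

  splitʷ : ∀ j {k u w} → Walk G u w (j + k) → ∃[ v ] Walk G u v j × Walk G v w k
  splitʷ zero    W       = _ , [] , W
  splitʷ (suc j) (e ∷ W) with splitʷ j W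
  ... | v , W₁ , W₂ = v , e ∷ W₁ , W₂

  resize : ∀ {u v j k} → j ≡ k → Walk G u v j → Walk G u v k
  resize refl W = W

  lineWalk : ∀ n (h : Fin (suc n) → Graph.Vertex G) →
             (∀ c c′ → toℕ c′ ≡ suc (toℕ c) → G ⊢ h c ~ h c′) →
             ∀ c → Walk G (h c) (h (fromℕ n)) (n ∸ toℕ c)
  lineWalk zero    h step zero    = []
  lineWalk (suc n) h step zero    =
    step zero (suc zero) refl ∷
    lineWalk n (h ∘ suc) (λ c c′ p → step (suc c) (suc c′) (cong suc p)) zero
  lineWalk (suc n) h step (suc c) =
    lineWalk n (h ∘ suc) (λ c c′ p → step (suc c) (suc c′) (cong suc p)) c

least : {P : Pred ℕ 0ℓ} → Decidable P → ∀ r → P r → ∃[ k ] P k × k ≤ r × (∀ j → P j → k ≤ j)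
least {P} P? = <-rec _ go
  where
  go : ∀ r → (∀ {q} → q < r → P q → ∃[ k ] P k × k ≤ q × (∀ j → P j → k ≤ j)) →
       P r → ∃[ k ] P k × k ≤ r × (∀ j → P j → k ≤ j)
  go r rec pr with anyUpTo? P? r
  ... | yes (q , q<r , pq) with rec q<r pq
  ...   | k , pk , k≤q , min = k , pk , ≤-trans k≤q (<⇒≤ q<r) , min
  go r rec pr | no none = r , pr , ≤-refl , λ j pj → ≮⇒≥ λ j<r → none (j , j<r , pj)

walk? : (H : FiniteGraph) → ∀ k u v → Dec (Walk (graph H) u v k)
walk? H zero    u v = map′ (λ { refl → [] }) (λ { [] → refl }) (u Fin.≟ v)
walk? H (suc k) u v =
  map′ (λ { (w , e , W) → e ∷ W }) (λ { (e ∷ W) → _ , e , W })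
       (Fin.any? λ w → T? (adj H u w) ×-dec walk? H k w v)

-- A ball is defined through an exact distance, so a shortest walk must be produced; in a finite
-- graph walks of given length are decidable and the least length can be searched for.
walk⇒ball : (H : FiniteGraph) → ∀ {u v k r} → Walk (graph H) u v k → k ≤ r →
            Ball (graph H) u r v
walk⇒ball H {u} {v} {k} W k≤r with least (λ j → walk? H j u v) k W
... | j , V , j≤k , min = j , (V , min) , ≤-trans j≤k k≤r

flips : ℕ → Bool → Bool
flips zero    b = b
flips (suc k) b = flips k (not b)

flips-not : ∀ k b → flips k (not b) ≡ not (flips k b)
flips-not zero    b = refl
flips-not (suc k) b = flips-not k (not b)

flips-flips : ∀ k b → flips k (flips k b) ≡ b
flips-flips zero    b = refl
flips-flips (suc k) b =
  trans (cong (λ c → flips k c) (sym (flips-not k (not b))))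
        (trans (cong (flips k ∘ flips k) (not-involutive b)) (flips-flips k b))

module _ (H : FiniteGraph)
         (side : Fin (order H) → Bool) (bipartition : IsBipartition (graph H) side) where

  side-edge : ∀ {u v} → graph H ⊢ u ~ v → side v ≡ not (side u)
  side-edge e = ¬-not (bipartition e ∘ sym)

  side-walk : ∀ {u v k} → Walk (graph H) u v k → side v ≡ flips k (side u)
  side-walk []              = refl
  side-walk (_∷_ {k = k} e W) = trans (side-walk W) (cong (flips k) (side-edge e))

  -- Steps back and forth along an edge at u change the length by two.
  pad : ∀ {u v w k} e → graph H ⊢ u ~ v → side w ≡ flips (e + k) (side u) → Walk (graph H) u w k →
        Walk (graph H) u w (e + k)
  pad zero          _ _ W = W
  pad {u} {k = k} (suc zero) _ p W =
    ⊥-elim (not-¬ refl (trans (trans (sym (side-walk W)) p) (flips-not k (side u))))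
  pad {u} {k = k} (suc (suc e)) a p W =
    a ∷ (Graph.~-sym (graph H) a ∷
         pad e a (trans p (cong (flips (e + k)) (not-involutive (side u)))) W)

  -- The centre is the only point of its unit ball that is not a neighbour, and the condition on
  -- sides excludes it.
  ball1⇒edge : ∀ {u v} → side v ≢ side u → Ball (graph H) u 1 v → graph H ⊢ u ~ v
  ball1⇒edge p (_ , ([]     , _) , _) = ⊥-elim (p refl)
  ball1⇒edge p (_ , (e ∷ [] , _) , _) = e
  ball1⇒edge p (_ , (_ ∷ (_ ∷ _) , _) , s≤s ())

  module _ (d : ℕ)
           (helly : (centre : Fin (2 * d) → Fin (order H)) (radius : Fin (2 * d) → ℕ)
                    (class : Bool) →
                    (∀ i j → i ≢ j → ∃[ v ] Ball (graph H) (centre i) (radius i) v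
                                          × Ball (graph H) (centre j) (radius j) v
                                          × side v ≡ class) →
                    ∃[ v ] (∀ i → Ball (graph H) (centre i) (radius i) v × side v ≡ class))
           (i₀ : Fin d)
           (p q : Fin d → Fin (order H)) (r : Fin d → ℕ)
           (pp : ∀ i j → i ≢ j → ∃[ v ] graph H ⊢ p i ~ v × graph H ⊢ p j ~ v)
           (pq : ∀ i j → Walk (graph H) (p i) (q j) (suc (r j)))
           (qq : ∀ i j → i ≢ j → Walk (graph H) (q i) (q j) (r i + r j))
    where

    -- In the application `p i` is the value at the lower neighbour and `q i` the value at the upper
    -- end in direction `i`; `pp`, `pq` and `qq` treat the three kinds of pairs among the 2d balls.
    -- The class to search in is the one opposite to that of `p i₀`.
    commonPoint : ∃[ v ] (∀ i → graph H ⊢ p i ~ v) × (∀ i → Walk (graph H) v (q i) (r i))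
    commonPoint = v , near , far
      where
      class : Bool
      class = not (side (p i₀))

      side-p : ∀ i → not (side (p i)) ≡ class
      side-p i with i Fin.≟ i₀
      ... | yes refl = refl
      ... | no i≢i₀ with pp i i₀ i≢i₀
      ...   | v , e , e′ = trans (sym (side-edge e)) (side-edge e′)

      -- The first edge of the walk from `p i₀` leads into `class`, and `r j` edges remain.
      side-q : ∀ j → side (q j) ≡ flips (r j) class
      side-q j = side-walk (pq i₀ j)

      centre : Fin 2 × Fin d → Fin (order H)
      centre (zero  , i) = p i
      centre (suc _ , i) = q i

      radius : Fin 2 × Fin d → ℕ
      radius (zero  , i) = 1
      radius (suc _ , i) = r i

      Meet : Fin 2 × Fin d → Fin 2 × Fin d → Set
      Meet x y = ∃[ v ] Ball (graph H) (centre x) (radius x) v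
                      × Ball (graph H) (centre y) (radius y) v × side v ≡ class

      -- The second vertex of the walk from `p i` to `q j` is adjacent to `p i` and `r j` steps from
      -- `q j`.
      meet-pq : ∀ i j → Meet (zero , i) (suc zero , j)
      meet-pq i j with pq i j
      ... | e ∷ W = _ , walk⇒ball H (e ∷ []) ≤-refl , walk⇒ball H (reverseʷ W) ≤-refl
                      , trans (side-edge e) (side-p i)

      meet : ∀ x y → x ≢ y → Meet x y
      meet (zero , i) (zero , j) x≢y with pp i j (x≢y ∘ cong (zero ,_))
      ... | v , e , e′ = v , walk⇒ball H (e ∷ []) ≤-refl , walk⇒ball H (e′ ∷ []) ≤-refl
                           , trans (side-edge e) (side-p i)
      meet (zero , i) (suc zero , j) _ = meet-pq i j
      meet (suc zero , i) (zero , j) _ with meet-pq j i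
      ... | v , b , b′ , s = v , b′ , b , s
      -- The walk between the two centres has length equal to the sum of the radii, so the vertex
      -- after `r i` steps lies in both balls.
      meet (suc zero , i) (suc zero , j) x≢y with splitʷ (r i) (qq i j (x≢y ∘ cong (suc zero ,_)))
      ... | v , W , W′ = v , walk⇒ball H W ≤-refl , walk⇒ball H (reverseʷ W′) ≤-refl
                           , trans (side-walk W) (trans (cong (flips (r i)) (side-q i))
                                                        (flips-flips (r i) class))

      common : ∃[ v ] (∀ i → Ball (graph H) (centre (remQuot d i)) (radius (remQuot d i)) v
                           × side v ≡ class)
      common = helly (centre ∘ remQuot d) (radius ∘ remQuot d) class λ i j i≢j →
        meet (remQuot d i) (remQuot d j) λ eq → i≢j
          (trans (sym (combine-remQuot {2} d i))
                 (trans (cong (uncurry combine) eq) (combine-remQuot {2} d j)))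

      v : Fin (order H)
      v = proj₁ common

      inBall : ∀ x → Ball (graph H) (centre x) (radius x) v
      inBall x = subst (λ y → Ball (graph H) (centre y) (radius y) v)
                       (remQuot-combine (proj₁ x) (proj₂ x))
                       (proj₁ (proj₂ common (uncurry combine x)))

      side-v : side v ≡ class
      side-v = proj₂ (proj₂ common (combine (zero {1}) i₀))

      near : ∀ i → graph H ⊢ p i ~ v
      near i = ball1⇒edge (λ eq → not-¬ refl (trans (sym eq) (trans side-v (sym (side-p i)))))
                          (inBall (zero , i))

      far : ∀ i → Walk (graph H) v (q i) (r i)
      far i with inBall (suc zero , i)
      -- The sides of `v` and `q i` make the defect `r i ∸ k` even. The edge from `v` to `p i₀` is
      -- the one used for padding.
      ... | k , (W , _) , k≤r = resize (m∸n+n≡m k≤r)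
        (pad (r i ∸ k) (Graph.~-sym (graph H) (near i₀))
          (trans (side-q i) (cong₂ flips (sym (m∸n+n≡m k≤r)) (sym side-v))) (reverseʷ W))

-- Filling the box

Point : ℕ → ℕ → Set
Point d n = Vec (Fin (suc n)) d

Up : ∀ {d n} → Fin d → Point d n → Point d n → Set
Up i z z′ = ∃[ c ] z′ ≡ z [ i ]≔ c × toℕ c ≡ suc (toℕ (lookup z i))

point-up : ∀ {d n} (z : Point d n) i c → toℕ c ≡ suc (toℕ (lookup z i)) →
           point (z [ i ]≔ c) ≡ updateAt (point z) i ℤ.suc
point-up (b ∷ z) zero    c p = cong (_∷ point z) (cong ℤ.+_ p)
point-up (b ∷ z) (suc i) c p = cong (_ ∷_) (point-up z i c p)

point-up⁻ : ∀ {d n} (z z′ : Point d n) (i : Fin d) →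
            point z′ ≡ updateAt (point z) i ℤ.suc → Up i z z′
point-up⁻ (b ∷ z) (b′ ∷ z′) zero p with ∷-injective p
... | q , r = b′ , cong (b′ ∷_) (point-injective r) , ℤ.+-injective q
point-up⁻ (b ∷ z) (b′ ∷ z′) (suc i) p with ∷-injective p
... | q , r with point-up⁻ z z′ i r | Fin.toℕ-injective (ℤ.+-injective q)
...   | c , refl , eq | refl = c , refl , eq

Up⇒adjacent : ∀ {d n i} {z z′ : Point d n} → Up i z z′ → Box d n ⊢ z ~ z′
Up⇒adjacent {i = i} {z} (c , refl , p) = i , inj₁ (point-up z i c p)

adjacent⇒Up : ∀ {d n} {z z′ : Point d n} → Box d n ⊢ z ~ z′ → ∃[ i ] (Up i z z′ ⊎ Up i z′ z)
adjacent⇒Up {z = z} {z′} (i , inj₁ p) = i , inj₁ (point-up⁻ z z′ i p)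
adjacent⇒Up {z = z} {z′} (i , inj₂ p) = i , inj₂ (point-up⁻ z′ z i p)

Up-update : ∀ {d n} (z : Point d n) i c c′ → toℕ c′ ≡ suc (toℕ c) → Up i (z [ i ]≔ c) (z [ i ]≔ c′)
Up-update z i c c′ p = c′ , sym ([]≔-idempotent z i)
                          , trans p (cong (suc ∘ toℕ) (sym (lookup∘update i z c)))

rank : ∀ {d n} → Point d n → ℕ
rank []      = 0
rank (c ∷ z) = toℕ c + rank z

rank-up : ∀ {d n i} {z z′ : Point d n} → Up i z z′ → rank z′ ≡ suc (rank z)
rank-up {i = i} {z} (c , refl , p) = go z i c p
  where
  go : ∀ {d n} (z : Point d n) i c → toℕ c ≡ suc (toℕ (lookup z i)) →
       rank (z [ i ]≔ c) ≡ suc (rank z)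
  go (b ∷ z) zero    c p = cong (_+ rank z) p
  go (b ∷ z) (suc i) c p = trans (cong (toℕ b +_) (go z i c p)) (+-suc (toℕ b) (rank z))

rank-bound : ∀ {d n} (z : Point d n) → rank z ≤ d * n
rank-bound []      = z≤n
rank-bound (c ∷ z) = +-mono-≤ (Fin.toℕ≤pred[n] c) (rank-bound z)

-- Total because `Fin.pred` fixes 0; it is z - eᵢ only when coordinate `i` is positive, hence the
-- premise of `Up-down`.
down : ∀ {d n} → Point d n → Fin d → Point d n
down z i = z [ i ]≔ Fin.pred (lookup z i)

toℕ-pred : ∀ {n} (c : Fin (suc n)) → toℕ c ≢ 0 → toℕ c ≡ suc (toℕ (Fin.pred c))
toℕ-pred zero    c≢0 = ⊥-elim (c≢0 refl)
toℕ-pred (suc c) _   = cong suc (sym (Fin.toℕ-inject₁ c))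

Up-down : ∀ {d n} (z : Point d n) i → toℕ (lookup z i) ≢ 0 → Up i (down z i) z
Up-down z i p = subst (Up i (down z i)) ([]≔-lookup z i)
                      (Up-update z i _ (lookup z i) (toℕ-pred (lookup z i) p))

down-other : ∀ {d n} (z : Point d n) {i j} → i ≢ j → ∀ c →
             down z i [ j ]≔ c ≡ down (z [ j ]≔ c) i
down-other z {i} {j} i≢j c =
  trans ([]≔-commutes z i j i≢j)
        (cong (λ b → (z [ j ]≔ c) [ i ]≔ Fin.pred b) (sym (lookup∘update′ i≢j z c)))

End : ∀ n → Fin (suc n) → Set
End n c = toℕ c ≡ 0 ⊎ toℕ c ≡ n

boundaryAt : ∀ {d n} (z : Point d n) i → End n (lookup z i) → OnBoundary n z
boundaryAt (c ∷ z) zero    p = here p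
boundaryAt (c ∷ z) (suc i) p = there (boundaryAt z i p)

boundaryCoordinate : ∀ {d n} {z : Point d n} → OnBoundary n z → ∃[ i ] End n (lookup z i)
boundaryCoordinate (here p) = zero , p
boundaryCoordinate (there b) with boundaryCoordinate b
... | i , p = suc i , p

top-boundary : ∀ {d n} (z : Point d n) i → OnBoundary n (z [ i ]≔ fromℕ n)
top-boundary {n = n} z i = boundaryAt _ i
  (inj₂ (trans (cong toℕ (lookup∘update i z (fromℕ n))) (Fin.toℕ-fromℕ n)))

Up⇒down : ∀ {d n i} {z z′ : Point d n} → Up i z z′ → down z′ i ≡ z
Up⇒down {i = i} {z} (c , refl , p) rewrite lookup∘update i z c =
  trans ([]≔-idempotent z i)
    (trans (cong (z [ i ]≔_) (Fin.toℕ-injective (suc-injective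
             (trans (sym (toℕ-pred c λ c≡0 → 1+n≢0 (trans (sym p) c≡0))) p))))
           ([]≔-lookup z i))

-- The other coordinates are shared with the interior point `z`, and coordinate `i` of `z′` is a
-- successor; so `z′` can be on the boundary only through the value `n` there.
Up-boundary : ∀ {d n i} {z z′ : Point d n} → Up i z z′ → ¬ OnBoundary n z → OnBoundary n z′ →
              z′ ≡ z [ i ]≔ fromℕ n × n ≡ suc (toℕ (lookup z i))
Up-boundary {n = n} {i} {z} (c , refl , p) z∉ z′∈ with boundaryCoordinate z′∈
... | j , e with j Fin.≟ i
...   | no j≢i = ⊥-elim (z∉ (boundaryAt z j (subst (End n) (lookup∘update′ j≢i z c) e)))
...   | yes refl with subst (End n) (lookup∘update i z c) e
...     | inj₁ c≡0 = ⊥-elim (1+n≢0 (trans (sym p) c≡0))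
...     | inj₂ c≡n = cong (z [ i ]≔_) (Fin.toℕ-injective (trans c≡n (sym (Fin.toℕ-fromℕ n))))
                   , trans (sym c≡n) p

OppositeFaces : ∀ {d n} (H : Graph) → (Point d n → Graph.Vertex H) → Set
OppositeFaces {d} {n} H g = ∀ z i → toℕ (lookup z i) ≡ 0 → Walk H (g z) (g (z [ i ]≔ fromℕ n)) n

opposite-walks : ∀ {d n} (H : Graph) (g : Point d n → Graph.Vertex H) →
                 (∀ {i z z′} → Up i z z′ → H ⊢ g z ~ g z′) → OppositeFaces H g
opposite-walks {n = n} H g edges z i p =
  subst (λ y → Walk H (g y) (g (z [ i ]≔ fromℕ n)) n) ([]≔-lookup z i)
    (resize (cong (n ∸_) p)
      (lineWalk n (λ c → g (z [ i ]≔ c)) (λ c c′ q → edges (Up-update z i c c′ q)) (lookup z i)))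

module _ {d n : ℕ} (i₀ : Fin d) (H : FiniteGraph)
         (helly : BipartiteHelly (graph H) (2 * d))
         (g₀ : Point d n → Fin (order H))
         (edges : ∀ {i z z′} → OnBoundary n z → OnBoundary n z′ → Up i z z′ →
                  graph H ⊢ g₀ z ~ g₀ z′)
         (opposite : OppositeFaces (graph H) g₀) where

  Filled : ℕ → Point d n → Set
  Filled k z = OnBoundary n z ⊎ rank z < k

  -- All points of one rank are filled in the same step; no two of them are adjacent.
  record Filling (k : ℕ) : Set where
    field
      g       : Point d n → Fin (order H)
      extends : ∀ z → OnBoundary n z → g z ≡ g₀ z
      hom     : ∀ {i z z′} → Filled k z → Filled k z′ → Up i z z′ → graph H ⊢ g z ~ g z′
      axis    : ∀ z i → Filled k z →
                Walk (graph H) (g z) (g (z [ i ]≔ fromℕ n)) (n ∸ toℕ (lookup z i))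

  start : Filling 0
  start = record
    { g       = g₀
    ; extends = λ _ _ → refl
    ; hom     = λ { (inj₁ b) (inj₁ b′) u → edges b b′ u }
    ; axis    = λ { z i (inj₁ b) → axis₀ z i (boundaryCoordinate b) }
    }
    where
    -- Coordinate `j` puts `z` on the boundary. In another direction the whole line stays in that
    -- face and boundary edges form the walk. In direction `j` itself the line may cross the
    -- interior: from 0 the hypothesis on opposite faces is used, at `n` the walk is empty.
    axis₀ : ∀ z i → ∃[ j ] End n (lookup z j) →
            Walk (graph H) (g₀ z) (g₀ (z [ i ]≔ fromℕ n)) (n ∸ toℕ (lookup z i))
    axis₀ z i (j , e) with i Fin.≟ j
    axis₀ z i (j , inj₁ p) | yes refl = resize (cong (n ∸_) (sym p)) (opposite z i p)
    axis₀ z i (j , inj₂ p) | yes refl =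
      subst₂ (λ y k → Walk (graph H) (g₀ z) (g₀ y) k)
        (trans (sym ([]≔-lookup z i))
               (cong (z [ i ]≔_) (Fin.toℕ-injective (trans p (sym (Fin.toℕ-fromℕ n))))))
        (sym (trans (cong (n ∸_) p) (n∸n≡0 n))) []
    axis₀ z i (j , e) | no i≢j =
      subst (λ y → Walk (graph H) (g₀ y) (g₀ (z [ i ]≔ fromℕ n)) (n ∸ toℕ (lookup z i)))
        ([]≔-lookup z i)
        (lineWalk n (λ c → g₀ (z [ i ]≔ c))
          (λ c c′ q → edges (onLine c) (onLine c′) (Up-update z i c c′ q)) (lookup z i))
      where
      onLine : ∀ c → OnBoundary n (z [ i ]≔ c)
      onLine c = boundaryAt _ j (subst (End n) (sym (lookup∘update′ (i≢j ∘ sym) z c)) e)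

  module _ {k : ℕ} (φ : Filling k) where
    open Filling φ

    New : Point d n → Set
    New x = rank x ≡ k × ¬ OnBoundary n x

    new? : ∀ x → Dec (New x)
    new? x = (rank x ≟ k) ×-dec ¬? (onBoundary? n x)

    Fits : Point d n → Fin (order H) → Set
    Fits x v = (∀ i → graph H ⊢ g (down x i) ~ v)
             × (∀ i → Walk (graph H) v (g (x [ i ]≔ fromℕ n)) (n ∸ toℕ (lookup x i)))

    choose : ∀ x → New x → ∃[ v ] Fits x v
    choose x (rank≡k , interior) =
      commonPoint H (proj₁ helly) (proj₁ (proj₂ helly)) d (proj₂ (proj₂ helly)) i₀
        (λ i → g (down x i)) (λ i → g (x [ i ]≔ fromℕ n)) (λ i → n ∸ toℕ (lookup x i))
        pp pq qq
      where
      positive : ∀ i → toℕ (lookup x i) ≢ 0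
      positive i p = interior (boundaryAt x i (inj₁ p))

      below : ∀ i → suc (rank (down x i)) ≡ k
      below i = trans (sym (rank-up (Up-down x i (positive i)))) rank≡k

      down-filled : ∀ i → Filled k (down x i)
      down-filled i = inj₂ (≤-reflexive (below i))

      -- The common neighbour is the value at x - eᵢ - eⱼ, which lies in the box because `x` is
      -- interior, and is filled because its rank is smaller.
      pp : ∀ i j → i ≢ j → ∃[ v ] graph H ⊢ g (down x i) ~ v × graph H ⊢ g (down x j) ~ v
      pp i j i≢j = g w , Graph.~-sym (graph H) (hom w-filled (down-filled i) u)
                       , Graph.~-sym (graph H) (hom w-filled (down-filled j) u′)
        where
        w = down (down x i) j

        u : Up j w (down x i)
        u = Up-down (down x i) j
              (positive j ∘ trans (cong toℕ (sym (lookup∘update′ (i≢j ∘ sym) x _))))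

        u′ : Up i w (down x j)
        u′ = subst (λ y → Up i y (down x j))
               (trans (sym (down-other x i≢j _)) (cong (λ c → down x i [ j ]≔ Fin.pred c)
                 (sym (lookup∘update′ (i≢j ∘ sym) x _))))
               (Up-down (down x j) i (positive i ∘ trans (cong toℕ (sym (lookup∘update′ i≢j x _)))))

        w-filled : Filled k w
        w-filled = inj₂ (<-trans (≤-reflexive (sym (rank-up u))) (≤-reflexive (below i)))

      -- For i = j the lower neighbour starts on the same line, one step further back. Otherwise its
      -- line in direction `j` ends in the face zⱼ = n, one boundary edge below x[j≔n].
      pq : ∀ i j → Walk (graph H) (g (down x i)) (g (x [ j ]≔ fromℕ n)) (suc (n ∸ toℕ (lookup x j)))
      pq i j with i Fin.≟ j
      ... | yes refl = subst₂ (λ y l → Walk (graph H) (g (down x i)) (g y) l)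
              ([]≔-idempotent x i) length≡ (axis (down x i) i (down-filled i))
        where
        length≡ : n ∸ toℕ (lookup (down x i) i) ≡ suc (n ∸ toℕ (lookup x i))
        length≡ rewrite lookup∘update i x (Fin.pred (lookup x i))
                      | toℕ-pred (lookup x i) (positive i) =
          +-∸-assoc 1 (subst (_≤ n) (toℕ-pred (lookup x i) (positive i))
                                    (Fin.toℕ≤pred[n] (lookup x i)))
      ... | no i≢j = snoc
              (resize (cong (λ c → n ∸ toℕ c) (lookup∘update′ (i≢j ∘ sym) x _))
                      (axis (down x i) j (down-filled i)))
              (subst (λ y → graph H ⊢ g y ~ g (x [ j ]≔ fromℕ n)) (sym (down-other x i≢j _))
                (hom (inj₁ (subst (OnBoundary n) (down-other x i≢j _) (top-boundary (down x i) j)))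
                     (inj₁ (top-boundary x j))
                     (Up-down (x [ j ]≔ fromℕ n) i
                       (positive i ∘ trans (cong toℕ (sym (lookup∘update′ i≢j x _)))))))

      -- Both upper ends are boundary points, and their walks along `j` and `i` respectively end at
      -- the same corner, where both coordinates equal `n`.
      qq : ∀ i j → i ≢ j → Walk (graph H) (g (x [ i ]≔ fromℕ n)) (g (x [ j ]≔ fromℕ n))
                                  ((n ∸ toℕ (lookup x i)) + (n ∸ toℕ (lookup x j)))
      qq i j i≢j = resize (+-comm (n ∸ toℕ (lookup x j)) _)
        (toCorner i j i≢j ++ʷ reverseʷ (subst (λ y → Walk (graph H) (g (x [ j ]≔ fromℕ n)) (g y) _)
          ([]≔-commutes x j i (i≢j ∘ sym)) (toCorner j i (i≢j ∘ sym))))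
        where
        toCorner : ∀ i j → i ≢ j →
                   Walk (graph H) (g (x [ i ]≔ fromℕ n)) (g ((x [ i ]≔ fromℕ n) [ j ]≔ fromℕ n))
                                  (n ∸ toℕ (lookup x j))
        toCorner i j i≢j = resize (cong (λ c → n ∸ toℕ c) (lookup∘update′ (i≢j ∘ sym) x _))
          (axis (x [ i ]≔ fromℕ n) j (inj₁ (top-boundary x i)))

    g′ : Point d n → Fin (order H)
    g′ x with new? x
    ... | yes ν = proj₁ (choose x ν)
    ... | no _  = g x

    g′-new : ∀ x → New x → Fits x (g′ x)
    g′-new x ν with new? x
    ... | yes ν′ = proj₂ (choose x ν′)
    ... | no ¬ν  = ⊥-elim (¬ν ν)

    g′-old : ∀ x → ¬ New x → g′ x ≡ g x
    g′-old x ¬ν with new? x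
    ... | yes ν = ⊥-elim (¬ν ν)
    ... | no _  = refl

    g′-boundary : ∀ x → OnBoundary n x → g′ x ≡ g x
    g′-boundary x b = g′-old x λ ν → proj₂ ν b

    g′-rank : ∀ x → rank x ≢ k → g′ x ≡ g x
    g′-rank x r≢k = g′-old x λ ν → r≢k (proj₁ ν)

    old-filled : ∀ {x} → Filled (suc k) x → ¬ New x → Filled k x
    old-filled (inj₁ b) _ = inj₁ b
    old-filled {x} (inj₂ r≤k) ¬ν with m≤n⇒m<n∨m≡n (≤-pred r≤k) | onBoundary? n x
    ... | inj₁ r<k | _     = inj₂ r<k
    ... | inj₂ r≡k | yes b = inj₁ b
    ... | inj₂ r≡k | no ¬b = ⊥-elim (¬ν (r≡k , ¬b))

    step : Filling (suc k)
    step = record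
      { g = g′ ; extends = extends′ ; hom = λ {i} {z} {z′} → hom′ i z z′ ; axis = axis′ }
      where
      extends′ : ∀ z → OnBoundary n z → g′ z ≡ g₀ z
      extends′ z b = trans (g′-boundary z b) (extends z b)

      hom′ : ∀ i z z′ → Filled (suc k) z → Filled (suc k) z′ → Up i z z′ → graph H ⊢ g′ z ~ g′ z′
      hom′ i z z′ F F′ u = edge (new? z) (new? z′)
        where
        edge : Dec (New z) → Dec (New z′) → graph H ⊢ g′ z ~ g′ z′
        -- Here `z′` has rank k + 1, so it can be filled only as a boundary point. Then n - zᵢ = 1,
        -- and the walk kept for `z` is the edge sought.
        edge (yes ν) _ =
          subst (λ v → graph H ⊢ g′ z ~ v) (sym (g′-rank z′ λ r≡k →
                  1+n≢n (trans (sym (rank-up u)) (trans r≡k (sym (proj₁ ν))))))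
            (walk⇒edge (proj₂ (g′-new z ν) i))
          where
          b′ : OnBoundary n z′
          b′ = [ id , (λ r → ⊥-elim (1+n≰n
                 (subst (_≤ k) (trans (rank-up u) (cong suc (proj₁ ν))) (≤-pred r)))) ]′ F′

          top : z′ ≡ z [ i ]≔ fromℕ n × n ≡ suc (toℕ (lookup z i))
          top = Up-boundary u (proj₂ ν) b′

          walk⇒edge : Walk (graph H) (g′ z) (g (z [ i ]≔ fromℕ n)) (n ∸ toℕ (lookup z i)) →
                      graph H ⊢ g′ z ~ g z′
          walk⇒edge W with subst₂ (λ y l → Walk (graph H) (g′ z) (g y) l) (sym (proj₁ top))
                             (trans (cong (_∸ toℕ (lookup z i)) (proj₂ top))
                                    (m+n∸n≡m 1 (toℕ (lookup z i)))) W
          ... | e ∷ [] = e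
        -- `z` is the lower neighbour of `z′` in direction `i`, to which the new value was chosen
        -- adjacent.
        edge (no ¬ν) (yes ν′) =
          subst (λ v → graph H ⊢ v ~ g′ z′) (trans (cong g (Up⇒down u)) (sym (g′-old z ¬ν)))
            (proj₁ (g′-new z′ ν′) i)
        edge (no ¬ν) (no ¬ν′) =
          subst₂ (graph H ⊢_~_) (sym (g′-old z ¬ν)) (sym (g′-old z′ ¬ν′))
            (hom (old-filled F ¬ν) (old-filled F′ ¬ν′) u)

      axis′ : ∀ z i → Filled (suc k) z →
              Walk (graph H) (g′ z) (g′ (z [ i ]≔ fromℕ n)) (n ∸ toℕ (lookup z i))
      axis′ z i F = subst (λ v → Walk (graph H) (g′ z) v _)
                          (sym (g′-boundary _ (top-boundary z i))) (onAxis (new? z))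
        where
        onAxis : Dec (New z) → Walk (graph H) (g′ z) (g (z [ i ]≔ fromℕ n)) (n ∸ toℕ (lookup z i))
        onAxis (yes ν) = proj₂ (g′-new z ν) i
        onAxis (no ¬ν) = subst (λ v → Walk (graph H) v _ _) (sym (g′-old z ¬ν))
                               (axis z i (old-filled F ¬ν))

  filling : ∀ k → Filling k
  filling zero    = start
  filling (suc k) = step (filling k)

  fill : ∃[ g ] (∀ z → OnBoundary n z → g z ≡ g₀ z)
              × (∀ {i z z′} → Up i z z′ → graph H ⊢ g z ~ g z′)
  fill = g , extends , λ {_} {z} {z′} → hom (everywhere z) (everywhere z′)
    where
    open Filling (filling (suc (d * n)))

    everywhere : ∀ z → Filled (suc (d * n)) z
    everywhere z = inj₂ (s≤s (rank-bound z))

-- Correctness of the program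

sumTo-zero : ∀ k {f : ℕ → ℕ} → (∀ i → i < k → f i ≡ 0) → sumTo k f ≡ 0
sumTo-zero zero    z = refl
sumTo-zero (suc k) z = cong₂ _+_ (sumTo-zero k λ i i<k → z i (m<n⇒m<1+n i<k)) (z k ≤-refl)

sumTo-zero⁻ : ∀ k {f : ℕ → ℕ} → sumTo k f ≡ 0 → ∀ i → i < k → f i ≡ 0
sumTo-zero⁻ (suc k) {f} z i i<1+k with m≤n⇒m<n∨m≡n (≤-pred i<1+k)
... | inj₁ i<k  = sumTo-zero⁻ k (m+n≡0⇒m≡0 (sumTo k f) z) i i<k
... | inj₂ refl = m+n≡0⇒n≡0 (sumTo k f) z

module _ (H : FiniteGraph) (a : ℕ → ℕ)
         (matrix : ∀ u v → a (toℕ u * order H + toℕ v) ≡ (if adj H u v then 1 else 0)) where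

  -- By contraposition: when no walk exists every summand vanishes, which avoids locating a nonzero
  -- summand. `walk?` makes this constructive.
  walks⇒walk : ∀ k (u t : Fin (order H)) → walks a (order H) (toℕ t) k (toℕ u) ≢ 0 →
               Walk (graph H) u t k
  walks⇒walk k u t nz with walk? H k u t
  ... | yes W = W
  ... | no ¬W = ⊥-elim (nz (none k u ¬W))
    where
    none : ∀ k u → ¬ Walk (graph H) u t k → walks a (order H) (toℕ t) k (toℕ u) ≡ 0
    none zero u ¬W with u Fin.≟ t
    ... | yes refl = ⊥-elim (¬W [])
    ... | no u≢t with (toℕ u ∸ toℕ t) + (toℕ t ∸ toℕ u) in eq
    ...   | suc x = 0∸n≡0 x
    ...   | zero  = ⊥-elim (u≢t (Fin.toℕ-injective (≤-antisym
              (m∸n≡0⇒m≤n (m+n≡0⇒m≡0 (toℕ u ∸ toℕ t) eq))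
              (m∸n≡0⇒m≤n (m+n≡0⇒n≡0 (toℕ u ∸ toℕ t) eq)))))
    none (suc k) u ¬W = sumTo-zero (order H) λ i i<m →
      subst (λ i → gate (a (toℕ u * order H + i)) (walks a (order H) (toℕ t) k i) ≡ 0)
            (Fin.toℕ-fromℕ< i<m) (entry (fromℕ< i<m))
      where
      entry : ∀ w → gate (a (toℕ u * order H + toℕ w)) (walks a (order H) (toℕ t) k (toℕ w)) ≡ 0
      entry w rewrite matrix u w with adj H u w in eq
      ... | false = refl
      ... | true  = none k w λ W → ¬W (subst T (sym eq) tt ∷ W)

  walk⇒walks : ∀ {k} {u t : Fin (order H)} → Walk (graph H) u t k →
               walks a (order H) (toℕ t) k (toℕ u) ≢ 0
  walk⇒walks {t = t} [] rewrite n∸n≡0 (toℕ t) = λ ()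
  walk⇒walks {suc k} {u} {t} (_∷_ {v = w} e W) z
    with adj H u w | matrix u w | sumTo-zero⁻ (order H) z (toℕ w) (Fin.toℕ<n w)
  ... | true | q | z′ rewrite q = walk⇒walks W z′

-- Lexicographic positions of points and lines

index : ∀ {d n} → Point d n → Fin (suc n ^ d)
index []      = zero
index (c ∷ z) = combine c (index z)

coordinates-index : ∀ {d n} (z : Point d n) → coordinates d (index z) ≡ z
coordinates-index []      = refl
coordinates-index (c ∷ z) =
  cong₂ _∷_ (cong proj₁ (remQuot-combine c (index z)))
            (trans (cong (coordinates _ ∘ proj₂) (remQuot-combine c (index z)))
                   (coordinates-index z))

index-coordinates : ∀ {n} d (i : Fin (suc n ^ d)) → index (coordinates d i) ≡ i
index-coordinates zero    zero = refl
index-coordinates {n} (suc d) i =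
  trans (cong (combine (proj₁ (remQuot {suc n} (suc n ^ d) i))) (index-coordinates d _))
        (combine-remQuot {suc n} (suc n ^ d) i)

-- In checkDirection j l, this line is number B of block A.
OnLine : ∀ {d n} (z : Point d n) (i : Fin d) (l A B : ℕ) → Set
OnLine {n = n} z i l A B =
  ∀ c → toℕ (index (z [ i ]≔ c)) ≡ toℕ c * suc n ^ l + (A * suc n ^ suc l + B)

-- A leading coordinate `c₀` shifts every position by c₀ (n+1)^d, which is c₀ (n+1)^j whole blocks
-- since d = j + (l + 1); the number within the block is unchanged.
OnLine-∷ : ∀ {d n} (z : Point d n) i j l {A B} c₀ → j + suc l ≡ d →
           OnLine z i l A B → OnLine (c₀ ∷ z) (suc i) l (suc n ^ j * toℕ c₀ + A) B
OnLine-∷ {n = n} z i j l {A} {B} c₀ refl on c =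
  trans (Fin.toℕ-combine c₀ (index (z [ i ]≔ c)))
    (trans (cong₂ (λ M x → M * toℕ c₀ + x) (^-distribˡ-+-* (suc n) j (suc l)) (on c))
           (regroup (suc n ^ j) (suc n ^ suc l) (toℕ c₀) (toℕ c * suc n ^ l) A B))
  where
  regroup : ∀ M S c₀ x A B → M * S * c₀ + (x + (A * S + B)) ≡ x + ((M * c₀ + A) * S + B)
  regroup = solve-∀

-- For soundness: no line escapes the program. `A` and `B` are the lexicographic indices of the
-- coordinates before and after `i`.
locate : ∀ {d n} (z : Point d n) i → ∃[ j ] ∃[ l ] j + suc l ≡ d ×
         Σ[ A ∈ Fin (suc n ^ j) ] Σ[ B ∈ Fin (suc n ^ l) ] OnLine z i l (toℕ A) (toℕ B)
locate {suc d} {n} (_ ∷ z) zero = 0 , d , refl , zero , index z , λ c →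
  trans (Fin.toℕ-combine c (index z)) (cong (_+ toℕ (index z)) (*-comm (suc n ^ d) (toℕ c)))
locate {n = n} (c₀ ∷ z) (suc i) with locate z i
... | j , l , eq , A , B , on = suc j , l , cong suc eq , combine c₀ A , B ,
  subst (λ A → OnLine (c₀ ∷ z) (suc i) l A (toℕ B)) (sym (Fin.toℕ-combine c₀ A))
        (OnLine-∷ z i j l c₀ eq on)

-- For completeness: whatever the program inspects is a genuine line, so no spurious miss is
-- counted.
place : ∀ {d n} j l → j + suc l ≡ d → (A : Fin (suc n ^ j)) (B : Fin (suc n ^ l)) →
        Σ[ z ∈ Point d n ] Σ[ i ∈ Fin d ] OnLine z i l (toℕ A) (toℕ B)
place {n = n} zero l refl zero B = zero ∷ coordinates l B , zero , λ c →
  trans (Fin.toℕ-combine c (index (coordinates l B)))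
        (cong₂ _+_ (*-comm (suc n ^ l) (toℕ c)) (cong toℕ (index-coordinates l B)))
place {n = n} (suc j) l refl A B with Fin.combine-surjective {suc n} {suc n ^ j} A
... | c₀ , A′ , refl with place j l refl A′ B
...   | z , i , on = c₀ ∷ z , suc i ,
  subst (λ A → OnLine (c₀ ∷ z) (suc i) l A (toℕ B)) (sym (Fin.toℕ-combine c₀ A′))
        (OnLine-∷ z i j l c₀ refl on)

fromTable-toℕ : ∀ {k} (g : Fin k → ℕ) i → fromTable g (toℕ i) ≡ g i
fromTable-toℕ {k} g i with toℕ i <? k
... | yes p = cong g (Fin.fromℕ<-toℕ i p)
... | no ≮  = ⊥-elim (≮ (Fin.toℕ<n i))

-- The input tables and the verdict

module _ (d n : ℕ) (H : FiniteGraph) (1≤order : 1 ≤ order H)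
         (f : Hom (Boundary d n) (graph H)) where

  -- The default in the interior is vertex 0, in agreement with the 0 stored there in array 1; thus
  -- `input-values` holds at all points.
  boundaryValue : Point d n → Fin (order H)
  boundaryValue z with onBoundary? n z
  ... | yes b = app f (z , [ b ])
  ... | no  _ = fromℕ< 1≤order

  boundaryValue≡ : ∀ z (b : OnBoundary n z) → boundaryValue z ≡ app f (z , [ b ])
  boundaryValue≡ z b with onBoundary? n z
  ... | yes _ = refl
  ... | no ¬b = ⊥-elim (¬b b)

  input-values : ∀ z → array (input d n H f) 1 (toℕ (index z)) ≡ toℕ (boundaryValue z)
  input-values z with toℕ (index z) <? suc n ^ d
  ... | no ≮ = ⊥-elim (≮ (Fin.toℕ<n (index z)))
  ... | yes p rewrite Fin.fromℕ<-toℕ (index z) p | coordinates-index z with onBoundary? n z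
  ...   | yes b = refl
  ...   | no _  = sym (Fin.toℕ-fromℕ< 1≤order)

  -- The padding 0 is also a vertex number, as `H` is nonempty. Hence any position yields a valid
  -- target and the program logic needs no range checks.
  input-values< : ∀ p → array (input d n H f) 1 p < order H
  input-values< p with p <? suc n ^ d
  ... | no _  = 1≤order
  ... | yes q with onBoundary? n (coordinates d (fromℕ< q))
  ...   | yes b = Fin.toℕ<n _
  ...   | no _  = 1≤order

  input-matrix : ∀ u v →
                 array (input d n H f) 0 (toℕ u * order H + toℕ v) ≡ (if adj H u v then 1 else 0)
  input-matrix u v =
    trans (cong (array (input d n H f) 0) position)
      (trans (fromTable-toℕ (uncurry entry ∘ remQuot {order H} (order H)) (combine u v))
             (cong (uncurry entry) (remQuot-combine u v)))
    where
    entry : Fin (order H) → Fin (order H) → ℕ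
    entry u v = if adj H u v then 1 else 0

    position : toℕ u * order H + toℕ v ≡ toℕ (combine u v)
    position = sym (trans (Fin.toℕ-combine u v) (cong (_+ toℕ v) (*-comm (order H) (toℕ u))))

  fillable⇒opposite : Fillable d n (graph H) f → OppositeFaces (graph H) boundaryValue
  fillable⇒opposite (f̃ , agrees) z i p =
    subst₂ (λ u v → Walk (graph H) u v n)
      (on-boundary z (boundaryAt z i (inj₁ p))) (on-boundary _ (top-boundary z i))
      (opposite-walks (graph H) (app f̃) (λ u → Hom.app-pres f̃ (Up⇒adjacent u)) z i p)
    where
    on-boundary : ∀ y → OnBoundary n y → app f̃ y ≡ boundaryValue y
    on-boundary y b = trans (agrees (y , [ b ])) (sym (boundaryValue≡ y b))

  opposite⇒fillable : Fin d → BipartiteHelly (graph H) (2 * d) →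
                      OppositeFaces (graph H) boundaryValue → Fillable d n (graph H) f
  opposite⇒fillable i₀ helly opposite with fill i₀ H helly boundaryValue edges opposite
    where
    edges : ∀ {i z z′} → OnBoundary n z → OnBoundary n z′ → Up i z z′ →
            graph H ⊢ boundaryValue z ~ boundaryValue z′
    edges {z = z} {z′} b b′ u =
      subst₂ (graph H ⊢_~_) (sym (boundaryValue≡ z b)) (sym (boundaryValue≡ z′ b′))
        (Hom.app-pres f (Up⇒adjacent u))
  ... | g , extends , hom = record { app = g ; app-pres = pres } , agrees
    where
    pres : ∀ {u v} → Box d n ⊢ u ~ v → graph H ⊢ g u ~ g v
    pres adjacent with adjacent⇒Up adjacent
    ... | i , inj₁ u = hom u
    ... | i , inj₂ u = Graph.~-sym (graph H) (hom u)

    agrees : ∀ x → g (value x) ≡ app f x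
    agrees (z , [ b ]) = trans (extends z b′) (boundaryValue≡ z b′)
      where
      b′ : OnBoundary n z
      -- The proof stored in a boundary vertex is irrelevant; deciding membership again gives a
      -- usable one.
      b′ = recompute (onBoundary? n z) b

  module _ (X : ℕ) (n≤X : n ≤ X) (m≤X : order H ≤ X) where
    open Check X (array (input d n H f) 0) (array (input d n H f) 1) n (order H) n≤X m≤X
               input-values<

    module _ (z : Point d n) (i : Fin d) (l A B : ℕ) (on : OnLine z i l A B) where

      private
        p = A * suc n ^ suc l + B

        low : array (input d n H f) 1 p ≡ toℕ (boundaryValue (z [ i ]≔ zero))
        low = trans (cong (array (input d n H f) 1) (sym (on zero))) (input-values (z [ i ]≔ zero))

        high : array (input d n H f) 1 (p + n * suc n ^ l) ≡ toℕ (boundaryValue (z [ i ]≔ fromℕ n))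
        high = trans (cong (array (input d n H f) 1)
                 (trans (+-comm p _) (sym (trans (on (fromℕ n))
                   (cong (λ c → c * suc n ^ l + p) (Fin.toℕ-fromℕ n))))))
                 (input-values (z [ i ]≔ fromℕ n))

      miss≡0⇒walk : miss (n * suc n ^ l) p ≡ 0 →
                    Walk (graph H) (boundaryValue (z [ i ]≔ zero))
                                   (boundaryValue (z [ i ]≔ fromℕ n)) n
      miss≡0⇒walk eq rewrite low | high = walks⇒walk H _ input-matrix n _ _ λ w≡0 →
        1+n≢0 (trans (sym (cong (1 ∸_) w≡0)) eq)

      walk⇒miss≡0 : Walk (graph H) (boundaryValue (z [ i ]≔ zero))
                                   (boundaryValue (z [ i ]≔ fromℕ n)) n →
                    miss (n * suc n ^ l) p ≡ 0
      walk⇒miss≡0 W rewrite low | high = m≤n⇒m∸n≡0 (n≢0⇒n>0 (walk⇒walks H _ input-matrix W))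

    missTotal⇒along : ∀ j k → missTotal j k ≡ 0 →
                      ∀ i l → i < j → i + suc l ≡ j + k → missAlong i l ≡ 0
    missTotal⇒along (suc j) k eq i l i<1+j sum with m≤n⇒m<n∨m≡n (≤-pred i<1+j)
    ... | inj₁ i<j = missTotal⇒along j (suc k) (m+n≡0⇒m≡0 (missTotal j (suc k)) eq) i l i<j
                       (trans sum (sym (+-suc j k)))
    ... | inj₂ refl with +-cancelˡ-≡ (suc i) l k (trans (sym (+-suc i l)) sum)
    ...   | refl = m+n≡0⇒n≡0 (missTotal i (suc k)) eq

    along⇒missTotal : ∀ j k → (∀ i l → i + suc l ≡ j + k → missAlong i l ≡ 0) → missTotal j k ≡ 0
    along⇒missTotal zero    k z = refl
    along⇒missTotal (suc j) k z =
      cong₂ _+_ (along⇒missTotal j (suc k) λ i l eq → z i l (trans eq (+-suc j k)))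
                (z j k (+-suc j k))

    missTotal⇒opposite : missTotal d 0 ≡ 0 → OppositeFaces (graph H) boundaryValue
    missTotal⇒opposite eq z i z≡0 with locate z i
    ... | j , l , j+l , A , B , on =
      subst (λ y → Walk (graph H) (boundaryValue y) (boundaryValue (z [ i ]≔ fromℕ n)) n) z₀≡z
        (miss≡0⇒walk z i l (toℕ A) (toℕ B) on (sumTo-zero⁻ (suc n ^ l) (sumTo-zero⁻ (suc n ^ j)
          (missTotal⇒along d 0 eq j l (subst (j <_) j+l (m<m+n j (s≤s z≤n)))
            (trans j+l (sym (+-identityʳ d))))
          (toℕ A) (Fin.toℕ<n A)) (toℕ B) (Fin.toℕ<n B)))
      where
      z₀≡z : z [ i ]≔ zero ≡ z
      z₀≡z = trans (cong (z [ i ]≔_) (Fin.toℕ-injective (sym z≡0))) ([]≔-lookup z i)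

    opposite⇒missTotal : OppositeFaces (graph H) boundaryValue → missTotal d 0 ≡ 0
    opposite⇒missTotal opposite = along⇒missTotal d 0 λ j l eq →
      sumTo-zero (suc n ^ j) λ A A< → sumTo-zero (suc n ^ l) λ B B< →
        subst₂ (λ A B → miss (n * suc n ^ l) (A * suc n ^ suc l + B) ≡ 0)
          (Fin.toℕ-fromℕ< A<) (Fin.toℕ-fromℕ< B<)
          (line j l (trans eq (+-identityʳ d)) (fromℕ< A<) (fromℕ< B<))
      where
      line : ∀ j l → j + suc l ≡ d → (A : Fin (suc n ^ j)) (B : Fin (suc n ^ l)) →
             miss (n * suc n ^ l) (toℕ A * suc n ^ suc l + toℕ B) ≡ 0
      line j l eq A B with place j l eq A B
      ... | z , i , on = walk⇒miss≡0 z i l (toℕ A) (toℕ B) on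
        (subst (λ y → Walk (graph H) (boundaryValue (z [ i ]≔ zero)) (boundaryValue y) n)
          ([]≔-idempotent z i) (opposite (z [ i ]≔ zero) i (cong toℕ (lookup∘update i z zero))))

verdict : ∀ s {A} k → register s 0 ≡ 1 ∸ k → (k ≡ 0 → A) → (A → k ≡ 0) → Answers s A
verdict s zero    r sound complete = inj₁ (r , sound refl)
verdict s (suc k) r sound complete = inj₂ (trans r (0∸n≡0 k) , λ a → 1+n≢0 (complete a))

module _ (d : ℕ) (i₀ : Fin d) (n : ℕ) (H : FiniteGraph) (1≤order : 1 ≤ order H)
         (helly : BipartiteHelly (graph H) (2 * d)) (f : Hom (Boundary d n) (graph H)) where

  private
    -- `X` must dominate every loop limit: `n`, |H| and the powers (n+1)^i with i ≤ d. The powers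
    -- fit because |H| ≥ 1 gives n + 1 ≤ n + |H|, and the others because d ≥ 1.
    Y X : ℕ
    Y = n + order H
    X = Y ^ d

    1≤d : 1 ≤ d
    1≤d = ≤-trans (s≤s z≤n) (Fin.toℕ<n i₀)

    1+n≤Y : suc n ≤ Y
    1+n≤Y = subst (_≤ Y) (+-comm n 1) (+-monoʳ-≤ n 1≤order)

    instance
      Y-nonZero : NonZero Y
      Y-nonZero = >-nonZero (≤-trans (s≤s z≤n) 1+n≤Y)

    Y≤X : Y ≤ X
    Y≤X = subst (_≤ X) (^-identityʳ Y) (^-monoʳ-≤ Y 1≤d)

    n≤X : n ≤ X
    n≤X = ≤-trans (m≤m+n n (order H)) Y≤X

    m≤X : order H ≤ X
    m≤X = ≤-trans (m≤n+m (order H) n) Y≤X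

  open Logic X
  open Check X (array (input d n H f) 0) (array (input d n H f) 1) n (order H) n≤X m≤X
             (input-values< d n H 1≤order f)

  holeFilling-decides : Runs (holeFilling d) (input d n H f)
                             (λ s → Answers s (Fillable d n (graph H) f))
  holeFilling-decides = weaken
    (holeFilling-spec d (λ i i≤d → ≤-trans (^-monoˡ-≤ i 1+n≤Y) (^-monoʳ-≤ Y i≤d))
      (refl , refl , refl , refl) refl)
    (λ s _ r → verdict s (missTotal d 0) r
      (λ z → opposite⇒fillable d n H 1≤order f i₀ helly
               (missTotal⇒opposite d n H 1≤order f X n≤X m≤X z))
      (λ F → opposite⇒missTotal d n H 1≤order f X n≤X m≤X (fillable⇒opposite d n H 1≤order f F)))

theorem5p2 : (d : ℕ) → 1 ≤ d →
    Σ[ P ∈ Program ] Σ[ p ∈ List ℕ ]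
    ((n : ℕ) → 1 ≤ n →
    (H : FiniteGraph) → 1 ≤ FiniteGraph.order H →
    Connected (FiniteGraph.graph H) →
    BipartiteHelly (FiniteGraph.graph H) (2 * d) →
    (f : Hom (Boundary d n) (FiniteGraph.graph H)) →
    Σ[ s ∈ State ] Σ[ t ∈ ℕ ]
    (P ∶ input d n H f ⇓ s in-time t
    × t ≤ evalPoly p (n + FiniteGraph.order H)
    × Answers s (Fillable d n (FiniteGraph.graph H) f)))
theorem5p2 d 1≤d = holeFilling d , timePoly d (holeFilling d) ,
  λ n _ H 1≤order _ helly f →
    polynomialTime d (holeFilling d) (n + order H)
      (holeFilling-decides d (fromℕ< 1≤d) n H 1≤order helly f)
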